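{- Let $d\ge2$, let $f$ be a polynomial in $X_1,\dots,X_{d-1}$ with integer coefficients and constant term $0$ (with a fixed order of multiplication of variables in each monomial), and let $c\in\mathbb{Z}$. Let $R$ be a finite ring with Jacobson radical $J$, and let $S=R/J$ be the semisimple part of $R$. If $C_R$ and $C_S=C_{R/J}$ are the $V_{f,c}$-Salem numbers of $R$ and $S$, then $$C_R\ge C_S\,|J|^{\frac{d-1}{2}}.$$
   Context: Rings are unital with $1\neq 0$ and not necessarily commutative; a polynomial with integer coefficients is a $\mathbb{Z}$-linear combination of words in the variables, so that it defines a function $R^{d-1}\to R$. For a finite ring $R$, $V_{f,c}(R)=\{(x_1,\dots,x_d)\in R^d : x_d=f(x_1,\dots,x_{d-1})+c\}$. For a set $T\subseteq R^d$ and a character $\psi$ of the additive group of $R^d$, put $\widehat{T}(\psi)=\frac{1}{|R|^d}\sum_{x\in T}\psi(x)$. The set $T$ is called $C$-Salem if $|\widehat{T}(\psi)|\le C\,|R|^{ -d}\,|T|^{1/2}$ for all nontrivial additive characters $\psi$ of $R^d$. The $V_{f,c}$-Salem number of $R$ is the smallest $C$ such that $V_{f,c}(R)$ is $C$-Salem. -}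

module Defs where

open import Algebra.Bundles using (Ring)
import Algebra.Definitions.RawMonoid as RawMonoidDefs
import Algebra.Properties.Ring as RingProperties
open import Data.Bool.Base using (Bool; T)
open import Data.Bool.Properties using (T?)
open import Data.Fin.Base using (Fin; zero; suc)
import Data.Fin.Properties as Fin
open import Data.Integer.Base as ℤ using (ℤ; +_; -[1+_])
import Data.Integer.Properties as ℤ
open import Data.List.Base as List using (List; []; _∷_; filter; length; cartesianProductWith; deduplicate)
import Data.List.Membership.Propositional.Properties as Membership
open import Data.List.Membership.Setoid.Properties using (∈-deduplicate⁺)
open import Data.List.Relation.Unary.All as All using (_∷_)
open import Data.List.Relation.Unary.AllPairs using (AllPairs; _∷_)
open import Data.List.Relation.Unary.Any as Any using (Any; here; there)
import Data.List.Relation.Unary.Any.Properties as Any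
import Data.List.Relation.Unary.Unique.DecSetoid.Properties as Unique
open import Data.Nat.Base as ℕ using (ℕ; zero; suc)
import Data.Nat.Properties as ℕ
import Data.Nat.Solver
open import Data.Product using (∃-syntax; _×_; _,_; proj₁; proj₂)
open import Data.Rational.Base as ℚ using (ℚ; 0ℚ; 1ℚ; ½; ↥_; ↧ₙ_; 1/_)
import Data.Rational.Properties as ℚ
open import Data.Rational.Solver using (module +-*-Solver)
import Data.Rational.Unnormalised.Base as ℚᵘ
import Data.Rational.Unnormalised.Properties as ℚᵘ
open import Data.Sum.Base using (inj₁; inj₂)
open import Data.Vec.Functional as Vector using (Vector)
open import Function.Base using (_∘_)
open import Function.Bundles using (Inverse)
open import Function.Properties.Inverse using (Inverse⇒Injection)
open import Level using (Level; _⊔_) renaming (suc to lsuc)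
open import Relation.Binary.Bundles using (DecSetoid)
import Relation.Binary.Definitions as B
open import Relation.Binary.PropositionalEquality as ≡ using (_≡_)
import Relation.Binary.Reasoning.Setoid as SetoidReasoning
open import Relation.Nullary using (¬_; Dec; yes; no; contradiction; isYes)
open import Relation.Nullary.Decidable using (map′; via-injection; decidable-stable; toWitness; fromWitness)
open import Relation.Unary using (Pred; Decidable)

open +-*-Solver using (solve; _:=_) renaming (_:+_ to _⊕_; _:*_ to _⊗_; _:-_ to _⊖_; :-_ to ⊝_)
private module ℕS = Data.Nat.Solver.+-*-Solver

p≤∣p∣ : ∀ p → p ℚ.≤ ℚ.∣ p ∣
p≤∣p∣ p with ℚ.≤-total 0ℚ p
... | inj₁ h = ℚ.≤-reflexive (≡.sym (ℚ.0≤p⇒∣p∣≡p h))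
... | inj₂ h = ℚ.≤-trans h (ℚ.0≤∣p∣ p)

∣-∣≤⇒≤+ : ∀ p q {ε} → ℚ.∣ p ℚ.- q ∣ ℚ.≤ ε → p ℚ.≤ q ℚ.+ ε
∣-∣≤⇒≤+ p q {ε} h = ≡.subst (ℚ._≤ q ℚ.+ ε) (solve 2 (λ p q → q ⊕ (p ⊖ q) := p) ≡.refl p q)
  (ℚ.+-monoʳ-≤ q (ℚ.≤-trans (p≤∣p∣ (p ℚ.- q)) h))

≤+⇒-≤ : ∀ p q {ε} → p ℚ.≤ q ℚ.+ ε → p ℚ.- q ℚ.≤ ε
≤+⇒-≤ p q {ε} h = ≡.subst (p ℚ.- q ℚ.≤_) (solve 2 (λ q e → (q ⊕ e) ⊖ q := e) ≡.refl q ε)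
  (ℚ.+-monoˡ-≤ (ℚ.- q) h)

≤+⇒∣-∣≤ : ∀ p q {ε} → p ℚ.≤ q ℚ.+ ε → q ℚ.≤ p ℚ.+ ε → ℚ.∣ p ℚ.- q ∣ ℚ.≤ ε
≤+⇒∣-∣≤ p q {ε} h k with ℚ.∣p∣≡p∨∣p∣≡-p (p ℚ.- q)
... | inj₁ e = ≡.subst (ℚ._≤ ε) (≡.sym e) (≤+⇒-≤ p q h)
... | inj₂ e = ≡.subst (ℚ._≤ ε) (≡.sym (≡.trans e (solve 2 (λ p q → ⊝ (p ⊖ q) := q ⊖ p) ≡.refl p q))) (≤+⇒-≤ q p k)

½-pos : ∀ {ε} → 0ℚ ℚ.< ε → 0ℚ ℚ.< ½ ℚ.* ε
½-pos {ε} h = ≡.subst (ℚ._< ½ ℚ.* ε) (ℚ.*-zeroʳ ½) (ℚ.*-monoʳ-<-pos ½ h)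

½+½ : ∀ ε → ½ ℚ.* ε ℚ.+ ½ ℚ.* ε ≡ ε
½+½ ε = ≡.trans (≡.sym (ℚ.*-distribʳ-+ ε ½ ½)) (ℚ.*-identityˡ ε)

*-mono-≤-nonNeg : ∀ {p q r s} → 0ℚ ℚ.≤ q → 0ℚ ℚ.≤ r → p ℚ.≤ q → r ℚ.≤ s → p ℚ.* r ℚ.≤ q ℚ.* s
*-mono-≤-nonNeg {p} {q} {r} {s} 0≤q 0≤r p≤q r≤s = ℚ.≤-trans
  (ℚ.*-monoʳ-≤-nonNeg r {{ℚ.nonNegative 0≤r}} p≤q) (ℚ.*-monoˡ-≤-nonNeg q {{ℚ.nonNegative 0≤q}} r≤s)

IsCauchy : (ℕ → ℚ) → Set
IsCauchy x = ∀ ε → 0ℚ ℚ.< ε → ∃[ N ] ∀ m n → N ℕ.≤ m → N ℕ.≤ n → ℚ.∣ x m ℚ.- x n ∣ ℚ.≤ ε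

record ℝ : Set where
  constructor mkℝ
  field
    seq    : ℕ → ℚ
    cauchy : IsCauchy seq

open ℝ public

infix 4 _≈ℝ_ _≤ℝ_

-- The sequences are not quotiented: equality of reals is _≈ℝ_.
_≈ℝ_ : ℝ → ℝ → Set
x ≈ℝ y = ∀ ε → 0ℚ ℚ.< ε → ∃[ N ] ∀ n → N ℕ.≤ n → ℚ.∣ seq x n ℚ.- seq y n ∣ ℚ.≤ ε

_≤ℝ_ : ℝ → ℝ → Set
x ≤ℝ y = ∀ ε → 0ℚ ℚ.< ε → ∃[ N ] ∀ n → N ℕ.≤ n → seq x n ℚ.≤ seq y n ℚ.+ ε

ℚ⇒ℝ : ℚ → ℝ
ℚ⇒ℝ q = mkℝ (λ _ → q) λ ε 0<ε → 0 , λ _ _ _ _ →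
  ≡.subst (λ z → ℚ.∣ z ∣ ℚ.≤ ε) (≡.sym (ℚ.+-inverseʳ q)) (ℚ.<⇒≤ 0<ε)

ℕ⇒ℝ : ℕ → ℝ
ℕ⇒ℝ n = ℚ⇒ℝ (+ n ℚ./ 1)

infixl 6 _+ℝ_
infixl 7 _*ℝ_
infix  8 -ℝ_

_+ℝ_ : ℝ → ℝ → ℝ
x +ℝ y = mkℝ (λ n → seq x n ℚ.+ seq y n) λ ε 0<ε →
  let M , x-small = cauchy x (½ ℚ.* ε) (½-pos 0<ε)
      N , y-small = cauchy y (½ ℚ.* ε) (½-pos 0<ε)
  in M ℕ.⊔ N , λ m n m≥ n≥ → ≡.subst (_ ℚ.≤_) (½+½ ε)
       (ℚ.≤-trans
         (≡.subst (λ z → ℚ.∣ z ∣ ℚ.≤ ℚ.∣ seq x m ℚ.- seq x n ∣ ℚ.+ ℚ.∣ seq y m ℚ.- seq y n ∣)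
           (solve 4 (λ a b c d → (a ⊖ b) ⊕ (c ⊖ d) := (a ⊕ c) ⊖ (b ⊕ d)) ≡.refl
             (seq x m) (seq x n) (seq y m) (seq y n))
           (ℚ.∣p+q∣≤∣p∣+∣q∣ (seq x m ℚ.- seq x n) (seq y m ℚ.- seq y n)))
         (ℚ.+-mono-≤
           (x-small m n (ℕ.m⊔n≤o⇒m≤o M N m≥) (ℕ.m⊔n≤o⇒m≤o M N n≥))
           (y-small m n (ℕ.m⊔n≤o⇒n≤o M N m≥) (ℕ.m⊔n≤o⇒n≤o M N n≥))))

-ℝ_ : ℝ → ℝ
-ℝ x = mkℝ (λ n → ℚ.- seq x n) λ ε 0<ε →
  let N , small = cauchy x ε 0<ε in
  N , λ m n m≥ n≥ → ≡.subst (λ z → ℚ.∣ z ∣ ℚ.≤ ε)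
    (solve 2 (λ a b → b ⊖ a := (⊝ a) ⊖ (⊝ b)) ≡.refl (seq x m) (seq x n))
    (small n m n≥ m≥)

eventually-bounded : ∀ x → ∃[ B ] 1ℚ ℚ.≤ B × (∃[ N ] ∀ n → N ℕ.≤ n → ℚ.∣ seq x n ∣ ℚ.≤ B)
eventually-bounded x =
  let N , small = cauchy x 1ℚ (ℚ.positive⁻¹ 1ℚ)
      b = ℚ.∣ seq x N ∣
  in b ℚ.+ 1ℚ
   , ≡.subst (ℚ._≤ b ℚ.+ 1ℚ) (ℚ.+-identityˡ 1ℚ) (ℚ.+-monoˡ-≤ 1ℚ (ℚ.0≤∣p∣ (seq x N)))
   , N , λ n n≥ → ℚ.≤-trans
       (≡.subst (λ z → ℚ.∣ z ∣ ℚ.≤ b ℚ.+ ℚ.∣ seq x n ℚ.- seq x N ∣)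
         (solve 2 (λ a c → c ⊕ (a ⊖ c) := a) ≡.refl (seq x n) (seq x N))
         (ℚ.∣p+q∣≤∣p∣+∣q∣ (seq x N) (seq x n ℚ.- seq x N)))
       (ℚ.+-monoʳ-≤ b (small n N n≥ ℕ.≤-refl))

scale : ∀ B → 1ℚ ℚ.≤ B → ∀ ε → 0ℚ ℚ.< ε → ∃[ η ] 0ℚ ℚ.< η × B ℚ.* η ≡ ½ ℚ.* ε
scale B 1≤B ε 0<ε = η , 0<η , Bη
  where
  0<B : 0ℚ ℚ.< B
  0<B = ℚ.<-≤-trans (ℚ.positive⁻¹ 1ℚ) 1≤B
  instance
    posB : ℚ.Positive B
    posB = ℚ.positive 0<B
    nzB : ℚ.NonZero B
    nzB = ℚ.pos⇒nonZero B
    pos1/B : ℚ.Positive (1/ B)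
    pos1/B = ℚ.1/pos⇒pos B
  η = 1/ B ℚ.* (½ ℚ.* ε)
  0<η : 0ℚ ℚ.< η
  0<η = ≡.subst (ℚ._< η) (ℚ.*-zeroʳ (1/ B)) (ℚ.*-monoʳ-<-pos (1/ B) (½-pos 0<ε))
  Bη : B ℚ.* η ≡ ½ ℚ.* ε
  Bη = ≡.trans (≡.sym (ℚ.*-assoc B (1/ B) (½ ℚ.* ε)))
         (≡.trans (≡.cong (ℚ._* (½ ℚ.* ε)) (ℚ.*-inverseʳ B)) (ℚ.*-identityˡ _))

_*ℝ_ : ℝ → ℝ → ℝ
x *ℝ y = mkℝ (λ n → seq x n ℚ.* seq y n) λ ε 0<ε →
  let A , 1≤A , K , x-bdd = eventually-bounded x
      B , 1≤B , L , y-bdd = eventually-bounded y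
      η , 0<η , Aη = scale A 1≤A ε 0<ε
      θ , 0<θ , Bθ = scale B 1≤B ε 0<ε
      M , x-small = cauchy x θ 0<θ
      N , y-small = cauchy y η 0<η
      0≤A = ℚ.≤-trans (ℚ.nonNegative⁻¹ 1ℚ) 1≤A
      0≤B = ℚ.≤-trans (ℚ.nonNegative⁻¹ 1ℚ) 1≤B
  in (K ℕ.⊔ L) ℕ.⊔ (M ℕ.⊔ N) , λ m n m≥ n≥ →
       let a = seq x m ; b = seq x n ; c = seq y m ; d = seq y n
           KL≤m = ℕ.m⊔n≤o⇒m≤o (K ℕ.⊔ L) (M ℕ.⊔ N) m≥
           KL≤n = ℕ.m⊔n≤o⇒m≤o (K ℕ.⊔ L) (M ℕ.⊔ N) n≥
           MN≤m = ℕ.m⊔n≤o⇒n≤o (K ℕ.⊔ L) (M ℕ.⊔ N) m≥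
           MN≤n = ℕ.m⊔n≤o⇒n≤o (K ℕ.⊔ L) (M ℕ.⊔ N) n≥
           first : ℚ.∣ a ℚ.* (c ℚ.- d) ∣ ℚ.≤ ½ ℚ.* ε
           first = ≡.subst₂ ℚ._≤_ (≡.sym (ℚ.∣p*q∣≡∣p∣*∣q∣ a (c ℚ.- d))) Aη
             (*-mono-≤-nonNeg 0≤A (ℚ.0≤∣p∣ (c ℚ.- d)) (x-bdd m (ℕ.m⊔n≤o⇒m≤o K L KL≤m))
               (y-small m n (ℕ.m⊔n≤o⇒n≤o M N MN≤m) (ℕ.m⊔n≤o⇒n≤o M N MN≤n)))
           second : ℚ.∣ d ℚ.* (a ℚ.- b) ∣ ℚ.≤ ½ ℚ.* ε
           second = ≡.subst₂ ℚ._≤_ (≡.sym (ℚ.∣p*q∣≡∣p∣*∣q∣ d (a ℚ.- b))) Bθ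
             (*-mono-≤-nonNeg 0≤B (ℚ.0≤∣p∣ (a ℚ.- b)) (y-bdd n (ℕ.m⊔n≤o⇒n≤o K L KL≤n))
               (x-small m n (ℕ.m⊔n≤o⇒m≤o M N MN≤m) (ℕ.m⊔n≤o⇒m≤o M N MN≤n)))
       in ℚ.≤-trans
            (≡.subst (λ z → ℚ.∣ z ∣ ℚ.≤ ℚ.∣ a ℚ.* (c ℚ.- d) ∣ ℚ.+ ℚ.∣ d ℚ.* (a ℚ.- b) ∣)
              (solve 4 (λ a b c d → (a ⊗ (c ⊖ d)) ⊕ (d ⊗ (a ⊖ b)) := (a ⊗ c) ⊖ (b ⊗ d)) ≡.refl a b c d)
              (ℚ.∣p+q∣≤∣p∣+∣q∣ (a ℚ.* (c ℚ.- d)) (d ℚ.* (a ℚ.- b))))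
            (≡.subst (_ ℚ.≤_) (½+½ ε) (ℚ.+-mono-≤ first second))

-- isqrt n = ⌊√n⌋; isqrt-step n takes ⌊√(n - 1)⌋ to ⌊√n⌋.
isqrt-step : ℕ → ℕ → ℕ
isqrt-step n r with suc r ℕ.* suc r ℕ.≤? n
... | yes _ = suc r
... | no  _ = r

isqrt : ℕ → ℕ
isqrt zero    = 0
isqrt (suc n) = isqrt-step (suc n) (isqrt n)

-- For q = p / r ≥ 0 in lowest terms this is ⌊√(p r (n + 1)²)⌋ / (r (n + 1)),
-- so that √ℚ⁺ q n ≤ √q < √ℚ⁺ q n + 1 / (n + 1).
√ℚ⁺ : ℚ → ℕ → ℚ
√ℚ⁺ q n = + isqrt (ℤ.∣ ↥ q ∣ ℕ.* ↧ₙ q ℕ.* (suc n ℕ.* suc n)) ℚ./ (↧ₙ q ℕ.* suc n)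

-- Negative rationals are sent to 0.
√ℚ : ℚ → ℕ → ℚ
√ℚ q = √ℚ⁺ (0ℚ ℚ.⊔ q)

isqrt-spec : ∀ n → isqrt n ℕ.* isqrt n ℕ.≤ n × n ℕ.< suc (isqrt n) ℕ.* suc (isqrt n)
isqrt-spec zero = ℕ.z≤n , ℕ.s≤s ℕ.z≤n
isqrt-spec (suc n) with isqrt n | isqrt-spec n
... | r | r²≤n , n<[1+r]² with suc r ℕ.* suc r ℕ.≤? suc n
...   | yes [1+r]²≤1+n = [1+r]²≤1+n , ℕ.≤-<-trans n<[1+r]² (ℕ.*-mono-< (ℕ.n<1+n (suc r)) (ℕ.n<1+n (suc r)))
...   | no  [1+r]²≰1+n = ℕ.m≤n⇒m≤1+n r²≤n , ℕ.≰⇒> [1+r]²≰1+n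

toℚᵘ-/ : ∀ k e → ℚ.toℚᵘ (+ k ℚ./ suc e) ℚᵘ.≃ ℚᵘ.mkℚᵘ (+ k) e
toℚᵘ-/ k e = ℚ.toℚᵘ-fromℚᵘ (ℚᵘ.mkℚᵘ (+ k) e)

toℚᵘ-/² : ∀ k e → ℚ.toℚᵘ ((+ k ℚ./ suc e) ℚ.* (+ k ℚ./ suc e)) ℚᵘ.≃ ℚᵘ.mkℚᵘ (+ k) e ℚᵘ.* ℚᵘ.mkℚᵘ (+ k) e
toℚᵘ-/² k e = ℚᵘ.≃-trans (ℚ.toℚᵘ-homo-* (+ k ℚ./ suc e) (+ k ℚ./ suc e)) (ℚᵘ.*-cong (toℚᵘ-/ k e) (toℚᵘ-/ k e))

↥≡+∣↥∣ : ∀ q → 0ℚ ℚ.≤ q → ↥ q ≡ + ℤ.∣ ↥ q ∣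
↥≡+∣↥∣ (ℚ.mkℚ (+ _) _ _) _ = ≡.refl
↥≡+∣↥∣ (ℚ.mkℚ ℤ.-[1+ n ] _ _) h with ℚ.nonNegative h
... | ()

square-≤ : ∀ k e q → 0ℚ ℚ.≤ q → k ℕ.* k ℕ.* ↧ₙ q ℕ.≤ ℤ.∣ ↥ q ∣ ℕ.* (suc e ℕ.* suc e) →
           (+ k ℚ./ suc e) ℚ.* (+ k ℚ./ suc e) ℚ.≤ q
square-≤ k e q@(ℚ.mkℚ _ _ _) 0≤q h = ℚ.toℚᵘ-cancel-≤ (ℚᵘ.≤-respˡ-≃ (ℚᵘ.≃-sym (toℚᵘ-/² k e)) (ℚᵘ.*≤* (≡.subst₂ ℤ._≤_
  (≡.trans (ℤ.pos-* (k ℕ.* k) (↧ₙ q)) (≡.cong (ℤ._* (+ ↧ₙ q)) (ℤ.pos-* k k)))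
  (≡.trans (ℤ.pos-* ℤ.∣ ↥ q ∣ _) (≡.cong (ℤ._* (+ (suc e ℕ.* suc e))) (≡.sym (↥≡+∣↥∣ q 0≤q))))
  (ℤ.+≤+ h))))

square-> : ∀ k e q → 0ℚ ℚ.≤ q → ℤ.∣ ↥ q ∣ ℕ.* (suc e ℕ.* suc e) ℕ.< k ℕ.* k ℕ.* ↧ₙ q →
           q ℚ.< (+ k ℚ./ suc e) ℚ.* (+ k ℚ./ suc e)
square-> k e q@(ℚ.mkℚ _ _ _) 0≤q h = ℚ.toℚᵘ-cancel-< (ℚᵘ.<-respʳ-≃ (ℚᵘ.≃-sym (toℚᵘ-/² k e)) (ℚᵘ.*<* (≡.subst₂ ℤ._<_
  (≡.trans (ℤ.pos-* ℤ.∣ ↥ q ∣ _) (≡.cong (ℤ._* (+ (suc e ℕ.* suc e))) (≡.sym (↥≡+∣↥∣ q 0≤q))))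
  (≡.trans (ℤ.pos-* (k ℕ.* k) (↧ₙ q)) (≡.cong (ℤ._* (+ ↧ₙ q)) (ℤ.pos-* k k)))
  (ℤ.+<+ h))))

/-nonNeg : ∀ k e → 0ℚ ℚ.≤ + k ℚ./ suc e
/-nonNeg k e = ℚ.nonNegative⁻¹ _ {{ℚ.normalize-nonNeg k (suc e)}}

/-step : ∀ k r m → + suc k ℚ./ (suc r ℕ.* suc m) ℚ.≤ (+ k ℚ./ (suc r ℕ.* suc m)) ℚ.+ (+ 1 ℚ./ suc m)
/-step k r m = ℚ.toℚᵘ-cancel-≤ (ℚᵘ.≤-respˡ-≃ (ℚᵘ.≃-sym (toℚᵘ-/ (suc k) e))
    (ℚᵘ.≤-respʳ-≃ (ℚᵘ.≃-sym (ℚᵘ.≃-trans (ℚ.toℚᵘ-homo-+ (+ k ℚ./ suc e) (+ 1 ℚ./ suc m))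
      (ℚᵘ.+-cong (toℚᵘ-/ k e) (toℚᵘ-/ 1 m))))
    (ℚᵘ.*≤* (≡.subst₂ ℤ._≤_ (ℤ.pos-* (suc k) (suc e ℕ.* suc m))
      (≡.trans (ℤ.pos-* (k ℕ.* suc m ℕ.+ 1 ℕ.* suc e) (suc e))
        (≡.cong (ℤ._* (+ suc e)) (≡.cong₂ ℤ._+_ (ℤ.pos-* k (suc m)) (ℤ.pos-* 1 (suc e)))))
      (ℤ.+≤+ arith)))))
  where
  e = m ℕ.+ r ℕ.* suc m
  arith : suc k ℕ.* (suc e ℕ.* suc m) ℕ.≤ (k ℕ.* suc m ℕ.+ 1 ℕ.* suc e) ℕ.* suc e
  arith = begin
    suc k ℕ.* (suc e ℕ.* suc m)               ≡⟨ ≡.cong (suc k ℕ.*_) (ℕ.*-comm (suc e) (suc m)) ⟩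
    suc k ℕ.* (suc m ℕ.* suc e)               ≡⟨ ≡.sym (ℕ.*-assoc (suc k) (suc m) (suc e)) ⟩
    suc k ℕ.* suc m ℕ.* suc e                 ≡⟨ ≡.cong (ℕ._* suc e) (ℕ.+-comm (suc m) (k ℕ.* suc m)) ⟩
    (k ℕ.* suc m ℕ.+ suc m) ℕ.* suc e         ≤⟨ ℕ.*-monoˡ-≤ (suc e) (ℕ.+-monoʳ-≤ (k ℕ.* suc m)
                                                  (ℕ.≤-trans (ℕ.s≤s (ℕ.m≤m+n m (r ℕ.* suc m)))
                                                    (ℕ.≤-reflexive (≡.sym (ℕ.*-identityˡ (suc e)))))) ⟩
    (k ℕ.* suc m ℕ.+ 1 ℕ.* suc e) ℕ.* suc e   ∎
    where open ℕ.≤-Reasoning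

√ℚ-nonNeg : ∀ q n → 0ℚ ℚ.≤ √ℚ q n
√ℚ-nonNeg q n = /-nonNeg (isqrt (ℤ.∣ ↥ q⁺ ∣ ℕ.* ↧ₙ q⁺ ℕ.* (suc n ℕ.* suc n))) (ℕ.pred (↧ₙ q⁺ ℕ.* suc n))
  where
  q⁺ = 0ℚ ℚ.⊔ q

√ℚ-spec : ∀ q n → let s = √ℚ q n ; t = s ℚ.+ (+ 1 ℚ./ suc n) in
          s ℚ.* s ℚ.≤ 0ℚ ℚ.⊔ q × 0ℚ ℚ.⊔ q ℚ.< t ℚ.* t
√ℚ-spec q n = lower , upper
  where
  q⁺ = 0ℚ ℚ.⊔ q
  0≤q⁺ = ℚ.p≤p⊔q 0ℚ q
  p = ℤ.∣ ↥ q⁺ ∣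
  r = ↧ₙ q⁺
  m = suc n
  k = isqrt (p ℕ.* r ℕ.* (m ℕ.* m))
  e = ℕ.pred (r ℕ.* m)
  t = √ℚ q n ℚ.+ (+ 1 ℚ./ suc n)
  regroup : p ℕ.* r ℕ.* (m ℕ.* m) ℕ.* r ≡ p ℕ.* ((r ℕ.* m) ℕ.* (r ℕ.* m))
  regroup = ℕS.solve 3 (λ p r m → p ℕS.:* r ℕS.:* (m ℕS.:* m) ℕS.:* r ℕS.:= p ℕS.:* ((r ℕS.:* m) ℕS.:* (r ℕS.:* m))) ≡.refl p r m
  lower : √ℚ q n ℚ.* √ℚ q n ℚ.≤ q⁺
  lower = square-≤ k e q⁺ 0≤q⁺ (≡.subst (k ℕ.* k ℕ.* r ℕ.≤_) regroup
    (ℕ.*-monoˡ-≤ r (proj₁ (isqrt-spec (p ℕ.* r ℕ.* (m ℕ.* m))))))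
  above : q⁺ ℚ.< (+ suc k ℚ./ suc e) ℚ.* (+ suc k ℚ./ suc e)
  above = square-> (suc k) e q⁺ 0≤q⁺ (≡.subst (ℕ._< suc k ℕ.* suc k ℕ.* r) regroup
    (ℕ.*-monoˡ-< r (proj₂ (isqrt-spec (p ℕ.* r ℕ.* (m ℕ.* m))))))
  step : + suc k ℚ./ suc e ℚ.≤ t
  step = /-step k (ℚ.denominator-1 q⁺) n
  0≤t = ℚ.≤-trans (/-nonNeg (suc k) e) step
  upper : q⁺ ℚ.< t ℚ.* t
  upper = ℚ.<-≤-trans above (*-mono-≤-nonNeg 0≤t (/-nonNeg (suc k) e) step step)

⊔-≤+ : ∀ p q {ε} → 0ℚ ℚ.< ε → p ℚ.≤ q ℚ.+ ε → 0ℚ ℚ.⊔ p ℚ.≤ 0ℚ ℚ.⊔ q ℚ.+ ε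
⊔-≤+ p q {ε} 0<ε h = ℚ.⊔-lub
  (ℚ.+-mono-≤ (ℚ.p≤p⊔q 0ℚ q) (ℚ.<⇒≤ 0<ε))
  (ℚ.≤-trans h (ℚ.+-monoˡ-≤ ε (ℚ.p≤q⊔p 0ℚ q)))

root-close : ∀ {p q a b δ} → 0ℚ ℚ.< δ → 0ℚ ℚ.≤ b → a ℚ.* a ℚ.≤ p →
             q ℚ.< (b ℚ.+ δ) ℚ.* (b ℚ.+ δ) → p ℚ.≤ q ℚ.+ δ ℚ.* δ → a ℚ.≤ b ℚ.+ (δ ℚ.+ δ)
root-close {p} {q} {a} {b} {δ} 0<δ 0≤b a²≤p q<b' p≤q' = ℚ.≮⇒≥ λ b″<a →
  let 0≤δ  = ℚ.<⇒≤ 0<δ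
      b″   = b ℚ.+ (δ ℚ.+ δ)
      0≤b″ = ℚ.+-mono-≤ 0≤b (ℚ.+-mono-≤ 0≤δ 0≤δ)
      0≤a  = ℚ.≤-trans 0≤b″ (ℚ.<⇒≤ b″<a)
      extra = b ℚ.* δ ℚ.+ b ℚ.* δ ℚ.+ (δ ℚ.* δ ℚ.+ δ ℚ.* δ)
      0≤* : ∀ {x y} → 0ℚ ℚ.≤ x → 0ℚ ℚ.≤ y → 0ℚ ℚ.≤ x ℚ.* y
      0≤* {x} {y} hx hy = ≡.subst (ℚ._≤ x ℚ.* y) (ℚ.*-zeroˡ 0ℚ) (*-mono-≤-nonNeg hx ℚ.≤-refl hx hy)
      0≤extra = ℚ.+-mono-≤ (ℚ.+-mono-≤ (0≤* 0≤b 0≤δ) (0≤* 0≤b 0≤δ))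
                           (ℚ.+-mono-≤ (0≤* 0≤δ 0≤δ) (0≤* 0≤δ 0≤δ))
      base = (b ℚ.+ δ) ℚ.* (b ℚ.+ δ) ℚ.+ δ ℚ.* δ
      base≤ : base ℚ.≤ b″ ℚ.* b″
      base≤ = ≡.subst₂ ℚ._≤_ (ℚ.+-identityʳ base)
        (solve 2 (λ b d → ((b ⊕ d) ⊗ (b ⊕ d)) ⊕ (d ⊗ d) ⊕ ((b ⊗ d) ⊕ (b ⊗ d) ⊕ ((d ⊗ d) ⊕ (d ⊗ d)))
                      := (b ⊕ (d ⊕ d)) ⊗ (b ⊕ (d ⊕ d))) ≡.refl b δ)
        (ℚ.+-monoʳ-≤ base 0≤extra)
  in ℚ.<-irrefl ≡.refl (ℚ.≤-<-trans
       (ℚ.≤-trans (*-mono-≤-nonNeg 0≤a 0≤b″ (ℚ.<⇒≤ b″<a) (ℚ.<⇒≤ b″<a)) (ℚ.≤-trans a²≤p p≤q'))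
       (ℚ.<-≤-trans (ℚ.+-monoˡ-< (δ ℚ.* δ) q<b') base≤))

archimedean : ∀ ε → 0ℚ ℚ.< ε → ∃[ N ] ∀ n → N ℕ.≤ n → + 1 ℚ./ suc n ℚ.≤ ε
archimedean ε@(ℚ.mkℚ _ _ _) 0<ε = ↧ₙ ε , λ n N≤n → ℚ.toℚᵘ-cancel-≤ (ℚᵘ.≤-respˡ-≃ (ℚᵘ.≃-sym (toℚᵘ-/ 1 n))
  (ℚᵘ.*≤* (go ε 0<ε n N≤n)))
  where
  go : ∀ ε → 0ℚ ℚ.< ε → ∀ n → ↧ₙ ε ℕ.≤ n → + 1 ℤ.* (+ ↧ₙ ε) ℤ.≤ ↥ ε ℤ.* + suc n
  go (ℚ.mkℚ (+ suc p) r-1 _) _ n h = ≡.subst (ℤ._≤ + (suc p ℕ.* suc n)) (≡.sym (ℤ.*-identityˡ (+ suc r-1)))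
    (ℤ.+≤+ (ℕ.≤-trans h (ℕ.≤-trans (ℕ.n≤1+n n) (ℕ.m≤m+n (suc n) (p ℕ.* suc n)))))
  go (ℚ.mkℚ (+ 0) _ _) h with ℚ.positive h
  ... | ()
  go (ℚ.mkℚ ℤ.-[1+ _ ] _ _) h with ℚ.positive h
  ... | ()

-- The square root of max(x, 0).
√_ : ℝ → ℝ
√ x = mkℝ (λ n → √ℚ (seq x n) n) λ ε 0<ε →
  let δ = ½ ℚ.* ε
      0<δ = ½-pos 0<ε
      0<δδ = ≡.subst (ℚ._< δ ℚ.* δ) (ℚ.*-zeroʳ δ) (ℚ.*-monoʳ-<-pos δ {{ℚ.positive 0<δ}} 0<δ)
      M , small = cauchy x (δ ℚ.* δ) 0<δδ
      N , tiny  = archimedean δ 0<δ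
      half : ∀ m n → M ℕ.⊔ N ℕ.≤ m → M ℕ.⊔ N ℕ.≤ n → √ℚ (seq x m) m ℚ.≤ √ℚ (seq x n) n ℚ.+ ε
      half m n m≥ n≥ =
        let b   = √ℚ (seq x n) n
            b≤  = ℚ.+-monoʳ-≤ b (tiny n (ℕ.m⊔n≤o⇒n≤o M N n≥))
            0≤b = √ℚ-nonNeg (seq x n) n
            0≤t = ℚ.+-mono-≤ 0≤b (/-nonNeg 1 n)
        in ≡.subst (λ z → √ℚ (seq x m) m ℚ.≤ b ℚ.+ z) (½+½ ε)
             (root-close 0<δ 0≤b (proj₁ (√ℚ-spec (seq x m) m))
               (ℚ.<-≤-trans (proj₂ (√ℚ-spec (seq x n) n)) (*-mono-≤-nonNeg (ℚ.≤-trans 0≤t b≤) 0≤t b≤ b≤))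
               (⊔-≤+ (seq x m) (seq x n) 0<δδ (∣-∣≤⇒≤+ (seq x m) (seq x n)
                 (small m n (ℕ.m⊔n≤o⇒m≤o M N m≥) (ℕ.m⊔n≤o⇒m≤o M N n≥)))))
  in M ℕ.⊔ N , λ m n m≥ n≥ →
       ≤+⇒∣-∣≤ (√ℚ (seq x m) m) (√ℚ (seq x n) n) (half m n m≥ n≥) (half n m n≥ m≥)

record ℂ : Set where
  constructor _+i_
  field
    re : ℝ
    im : ℝ

open ℂ public

infix  4 _≈ℂ_
infixl 6 _+ℂ_
infixl 7 _*ℂ_

_≈ℂ_ : ℂ → ℂ → Set
z ≈ℂ w = re z ≈ℝ re w × im z ≈ℝ im w

ℝ⇒ℂ : ℝ → ℂ
ℝ⇒ℂ x = x +i ℕ⇒ℝ 0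

0ℂ 1ℂ : ℂ
0ℂ = ℝ⇒ℂ (ℕ⇒ℝ 0)
1ℂ = ℝ⇒ℂ (ℕ⇒ℝ 1)

_+ℂ_ _*ℂ_ : ℂ → ℂ → ℂ
z +ℂ w = (re z +ℝ re w) +i (im z +ℝ im w)
z *ℂ w = (re z *ℝ re w +ℝ -ℝ (im z *ℝ im w)) +i (re z *ℝ im w +ℝ im z *ℝ re w)

∣_∣ℂ : ℂ → ℝ
∣ z ∣ℂ = √ (re z *ℝ re z +ℝ im z *ℝ im z)

sumℂ : List ℂ → ℂ
sumℂ = List.foldr _+ℂ_ 0ℂ

record FiniteRing (a ℓ : Level) : Set (lsuc (a ⊔ ℓ)) where
  field
    ring : Ring a ℓ
  open Ring ring public
  field
    1≉0         : ¬ 1# ≈ 0#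
    order       : ℕ
    enumeration : Inverse setoid (≡.setoid (Fin order))

  open Inverse enumeration public using () renaming (to to index; from to element)

  elements : List Carrier
  elements = List.tabulate element

  infix 4 _≟_
  _≟_ : B.Decidable _≈_
  _≟_ = via-injection (Inverse⇒Injection enumeration) Fin._≟_

  order-nonZero : ℕ.NonZero order
  order-nonZero = Fin.nonZeroIndex (index 0#)

  element∘index : ∀ x → element (index x) ≈ x
  element∘index = Inverse.strictlyInverseʳ enumeration

  ∈-elements : ∀ x → Any (x ≈_) elements
  ∈-elements x = Any.tabulate⁺ (index x) (sym (element∘index x))

  exists? : ∀ {p} {P : Pred Carrier p} → P B.Respects _≈_ → Decidable P → Dec (∃[ x ] P x)
  exists? resp P? = map′ (λ (i , p) → element i , p)
    (λ (x , p) → index x , resp (sym (element∘index x)) p) (Fin.any? (P? ∘ element))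

  forall? : ∀ {p} {P : Pred Carrier p} → P B.Respects _≈_ → Decidable P → Dec (∀ x → P x)
  forall? resp P? = map′ (λ f x → resp (element∘index x) (f (index x)))
    (λ f i → f (element i)) (Fin.all? (P? ∘ element))

-- Ideals are given by Boolean-valued membership functions; for the finite rings
-- considered below every subset is of this form.
module _ {a ℓ} (R : Ring a ℓ) where
  open Ring R

  record IsLeftIdeal (I : Carrier → Bool) : Set (a ⊔ ℓ) where
    field
      resp     : ∀ {x y} → x ≈ y → T (I x) → T (I y)
      0∈       : T (I 0#)
      +-closed : ∀ {x y} → T (I x) → T (I y) → T (I (x + y))
      *-closed : ∀ r {x} → T (I x) → T (I (r * x))

  record IsMaximalLeftIdeal (I : Carrier → Bool) : Set (a ⊔ ℓ) where
    field
      isLeftIdeal : IsLeftIdeal I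
      proper      : ¬ T (I 1#)
      maximal     : ∀ K → IsLeftIdeal K → ¬ T (K 1#) →
                    (∀ x → T (I x) → T (K x)) → ∀ x → T (K x) → T (I x)

    open IsLeftIdeal isLeftIdeal public

  -- The intersection of all maximal left ideals.
  JacobsonRadical : Pred Carrier (a ⊔ ℓ)
  JacobsonRadical x = ∀ I → IsMaximalLeftIdeal I → T (I x)

  LeftInvertible : Pred Carrier (a ⊔ ℓ)
  LeftInvertible x = ∃[ u ] u * x ≈ 1#

module _ {a ℓ} (R : FiniteRing a ℓ) where
  open FiniteRing R
  open RingProperties ring

  private
    module Eq = SetoidReasoning setoid
    J = JacobsonRadical ring

  -‿cong₂ : ∀ {x y u v} → x ≈ y → u ≈ v → x - u ≈ y - v
  -‿cong₂ p q = +-cong p (-‿cong q)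

  telescope : ∀ x y z → (x - y) + (y - z) ≈ x - z
  telescope x y z = begin
    (x - y) + (y - z)      ≈⟨ +-assoc x (- y) (y - z) ⟩
    x + (- y + (y - z))    ≈⟨ +-congˡ (sym (+-assoc (- y) y (- z))) ⟩
    x + ((- y + y) - z)    ≈⟨ +-congˡ (+-congʳ (-‿inverseˡ y)) ⟩
    x + (0# - z)           ≈⟨ +-congˡ (+-identityˡ (- z)) ⟩
    x - z                  ∎
    where open Eq

  swap : ∀ x y z w → (x + y) - (z + w) ≈ (x - z) + (y - w)
  swap x y z w = begin
    (x + y) + - (z + w)       ≈⟨ +-congˡ (sym (-‿+-comm z w)) ⟩
    (x + y) + (- z + - w)     ≈⟨ +-assoc x y (- z + - w) ⟩
    x + (y + (- z + - w))     ≈⟨ +-congˡ (sym (+-assoc y (- z) (- w))) ⟩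
    x + ((y + - z) + - w)     ≈⟨ +-congˡ (+-congʳ (+-comm y (- z))) ⟩
    x + ((- z + y) + - w)     ≈⟨ +-congˡ (+-assoc (- z) y (- w)) ⟩
    x + (- z + (y + - w))     ≈⟨ sym (+-assoc x (- z) (y - w)) ⟩
    (x - z) + (y - w)         ∎
    where open Eq

  x-0≈x : ∀ x → x - 0# ≈ x
  x-0≈x x = trans (+-congˡ -0#≈0#) (+-identityʳ x)

  x-y+y≈x : ∀ x y → (x - y) + y ≈ x
  x-y+y≈x x y = trans (+-assoc x (- y) y) (trans (+-congˡ (-‿inverseˡ y)) (+-identityʳ x))

  -‿closed : ∀ {I} → IsLeftIdeal ring I → ∀ {x} → T (I x) → T (I (- x))
  -‿closed isI {x} h = resp (-1*x≈-x x) (*-closed (- 1#) h)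
    where open IsLeftIdeal isI

  -- The left ideal I + R y.
  adjoin? : ∀ {I} → IsLeftIdeal ring I → ∀ y → Decidable (λ x → ∃[ s ] T (I (x - s * y)))
  adjoin? {I} isI y x = exists?
    (λ s≈t → IsLeftIdeal.resp isI (-‿cong₂ refl (*-congʳ s≈t)))
    (λ s → T? (I (x - s * y)))

  adjoin : ∀ {I} → IsLeftIdeal ring I → Carrier → Carrier → Bool
  adjoin isI y x = isYes (adjoin? isI y x)

  adjoin⁺ : ∀ {I} (isI : IsLeftIdeal ring I) y {x} → ∃[ s ] T (I (x - s * y)) → T (adjoin isI y x)
  adjoin⁺ isI y {x} = fromWitness {a? = adjoin? isI y x}

  adjoin⁻ : ∀ {I} (isI : IsLeftIdeal ring I) y {x} → T (adjoin isI y x) → ∃[ s ] T (I (x - s * y))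
  adjoin⁻ isI y {x} = toWitness {a? = adjoin? isI y x}

  ⊆-adjoin : ∀ {I} (isI : IsLeftIdeal ring I) y x → T (I x) → T (adjoin isI y x)
  ⊆-adjoin isI y x h = adjoin⁺ isI y (0# , resp (sym (trans (-‿cong₂ refl (zeroˡ y)) (x-0≈x x))) h)
    where open IsLeftIdeal isI

  ∈-adjoin : ∀ {I} (isI : IsLeftIdeal ring I) y → T (adjoin isI y y)
  ∈-adjoin isI y = adjoin⁺ isI y (1# , resp (sym (trans (-‿cong₂ refl (*-identityˡ y)) (-‿inverseʳ y))) 0∈)
    where open IsLeftIdeal isI

  adjoin-least : ∀ {I K} (isI : IsLeftIdeal ring I) → IsLeftIdeal ring K → ∀ y →
                 (∀ x → T (I x) → T (K x)) → T (K y) → ∀ x → T (adjoin isI y x) → T (K x)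
  adjoin-least isI isK y I⊆K y∈K x h =
    let s , p = adjoin⁻ isI y h in resp (x-y+y≈x x (s * y)) (+-closed (I⊆K _ p) (*-closed s y∈K))
    where open IsLeftIdeal isK

  adjoin-isLeftIdeal : ∀ {I} (isI : IsLeftIdeal ring I) y → IsLeftIdeal ring (adjoin isI y)
  adjoin-isLeftIdeal isI y = record
    { resp = λ x≈x′ h → let s , p = adjoin⁻ isI y h in adjoin⁺ isI y (s , resp (+-congʳ x≈x′) p)
    ; 0∈ = ⊆-adjoin isI y 0# 0∈
    ; +-closed = λ {x} {x′} h h′ →
        let s , p = adjoin⁻ isI y h
            t , q = adjoin⁻ isI y h′
        in adjoin⁺ isI y (s + t , resp
             (sym (trans (-‿cong₂ refl (distribʳ y s t)) (swap x x′ (s * y) (t * y)))) (+-closed p q))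
    ; *-closed = λ r {x} h → let s , p = adjoin⁻ isI y h in adjoin⁺ isI y (r * s , resp
        (trans (x[y-z]≈xy-xz r x (s * y)) (-‿cong₂ refl (sym (*-assoc r s y)))) (*-closed r p))
    }
    where open IsLeftIdeal isI

  ProperLeftIdeal : Set (a ⊔ ℓ)
  ProperLeftIdeal = ∃[ I ] IsLeftIdeal ring I × ¬ T (I 1#)

  grow : ProperLeftIdeal → Carrier → ProperLeftIdeal
  grow (I , isI , 1∉I) y with T? (adjoin isI y 1#)
  ... | yes _ = I , isI , 1∉I
  ... | no 1∉ = adjoin isI y , adjoin-isLeftIdeal isI y , 1∉

  ⊆-grow : ∀ I y x → T (proj₁ I x) → T (proj₁ (grow I y) x)
  ⊆-grow (I , isI , 1∉I) y x h with T? (adjoin isI y 1#)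
  ... | yes _ = h
  ... | no _  = ⊆-adjoin isI y x h

  ∈-grow : ∀ I y K → IsLeftIdeal ring K → ¬ T (K 1#) → (∀ x → T (proj₁ I x) → T (K x)) →
           T (K y) → T (proj₁ (grow I y) y)
  ∈-grow (I , isI , 1∉I) y K isK 1∉K I⊆K y∈K with T? (adjoin isI y 1#)
  ... | yes 1∈ = contradiction (adjoin-least isI isK y I⊆K y∈K 1# 1∈) 1∉K
  ... | no _   = ∈-adjoin isI y

  saturate : ProperLeftIdeal → List Carrier → ProperLeftIdeal
  saturate = List.foldl grow

  ⊆-saturate : ∀ I ys x → T (proj₁ I x) → T (proj₁ (saturate I ys) x)
  ⊆-saturate I []       x h = h
  ⊆-saturate I (y ∷ ys) x h = ⊆-saturate (grow I y) ys x (⊆-grow I y x h)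

  saturate-maximal : ∀ I ys K → IsLeftIdeal ring K → ¬ T (K 1#) →
                     (∀ x → T (proj₁ (saturate I ys) x) → T (K x)) →
                     ∀ {x} → Any (x ≈_) ys → T (K x) → T (proj₁ (saturate I ys) x)
  saturate-maximal I (y ∷ ys) K isK 1∉K S⊆K (here x≈y) x∈K =
    IsLeftIdeal.resp (proj₁ (proj₂ (saturate I (y ∷ ys)))) (sym x≈y)
      (⊆-saturate (grow I y) ys y
        (∈-grow I y K isK 1∉K (λ x → S⊆K x ∘ ⊆-saturate I (y ∷ ys) x) (IsLeftIdeal.resp isK x≈y x∈K)))
  saturate-maximal I (y ∷ ys) K isK 1∉K S⊆K (there x∈ys) x∈K =
    saturate-maximal (grow I y) ys K isK 1∉K S⊆K x∈ys x∈K

  ∃-maximal : ∀ I → IsLeftIdeal ring I → ¬ T (I 1#) →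
              ∃[ M ] IsMaximalLeftIdeal ring M × (∀ x → T (I x) → T (M x))
  ∃-maximal I isI 1∉I =
    let M , isM , 1∉M = saturate (I , isI , 1∉I) elements in
    M , record
      { isLeftIdeal = isM
      ; proper = 1∉M
      ; maximal = λ K isK 1∉K M⊆K x →
          saturate-maximal (I , isI , 1∉I) elements K isK 1∉K M⊆K (∈-elements x)
      } , ⊆-saturate (I , isI , 1∉I) elements

  zero-isLeftIdeal : IsLeftIdeal ring (λ x → isYes (x ≟ 0#))
  zero-isLeftIdeal = record
    { resp = λ x≈y h → in⁺ (trans (sym x≈y) (in⁻ h))
    ; 0∈ = in⁺ refl
    ; +-closed = λ h k → in⁺ (trans (+-cong (in⁻ h) (in⁻ k)) (+-identityˡ 0#))
    ; *-closed = λ r h → in⁺ (trans (*-congˡ (in⁻ h)) (zeroʳ r))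
    }
    where
    in⁺ : ∀ {x} → x ≈ 0# → T (isYes (x ≟ 0#))
    in⁺ {x} = fromWitness {a? = x ≟ 0#}
    in⁻ : ∀ {x} → T (isYes (x ≟ 0#)) → x ≈ 0#
    in⁻ {x} = toWitness {a? = x ≟ 0#}

  leftInvertible? : Decidable (LeftInvertible ring)
  leftInvertible? x = exists? (λ u≈v → trans (*-congʳ (sym u≈v))) (λ u → u * x ≟ 1#)

  J⇒leftInvertible : ∀ {x} → J x → ∀ r → LeftInvertible ring (1# - r * x)
  J⇒leftInvertible {x} x∈J r = decidable-stable (leftInvertible? y) λ ¬inv →
    let principal = adjoin-isLeftIdeal zero-isLeftIdeal y
        M , isM , Ry⊆M = ∃-maximal (adjoin zero-isLeftIdeal y) principal λ 1∈ →
          let s , p = adjoin⁻ zero-isLeftIdeal y 1∈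
              1-sy≈0 = toWitness {a? = (1# - s * y) ≟ 0#} p
          in ¬inv (s , trans (sym (+-identityˡ (s * y)))
                        (trans (+-congʳ (sym 1-sy≈0)) (x-y+y≈x 1# (s * y))))
        open IsMaximalLeftIdeal isM
    in proper (resp (x-y+y≈x 1# (r * x))
         (+-closed (Ry⊆M y (∈-adjoin zero-isLeftIdeal y)) (*-closed r (x∈J M isM))))
    where y = 1# - r * x

  leftInvertible⇒J : ∀ {x} → (∀ r → LeftInvertible ring (1# - r * x)) → J x
  leftInvertible⇒J {x} inv M isM = decidable-stable (T? (M x)) λ x∉M →
    x∉M (maximal (adjoin isLeftIdeal x) (adjoin-isLeftIdeal isLeftIdeal x)
      (λ 1∈ → let s , p = adjoin⁻ isLeftIdeal x 1∈
                  u , q = inv s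
              in proper (resp q (*-closed u p)))
      (⊆-adjoin isLeftIdeal x) x (∈-adjoin isLeftIdeal x))
    where open IsMaximalLeftIdeal isM

  J? : Decidable J
  J? x = map′ leftInvertible⇒J J⇒leftInvertible (forall?
    (λ r≈s (u , p) → u , trans (*-congˡ (-‿cong₂ refl (*-congʳ (sym r≈s)))) p)
    (λ r → leftInvertible? (1# - r * x)))

  J-resp : ∀ {x y} → x ≈ y → J x → J y
  J-resp x≈y h M isM = IsMaximalLeftIdeal.resp isM x≈y (h M isM)

  J-0 : J 0#
  J-0 M isM = IsMaximalLeftIdeal.0∈ isM

  J-+ : ∀ {x y} → J x → J y → J (x + y)
  J-+ h k M isM = IsMaximalLeftIdeal.+-closed isM (h M isM) (k M isM)

  J-*ˡ : ∀ r {x} → J x → J (r * x)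
  J-*ˡ r h M isM = IsMaximalLeftIdeal.*-closed isM r (h M isM)

  J-neg : ∀ {x} → J x → J (- x)
  J-neg {x} h = J-resp (-1*x≈-x x) (J-*ˡ (- 1#) h)

  -- If u (1 - y x) = 1 then (1 + x u y) (1 - x y) = 1.
  leftInvertible-swap : ∀ x y → LeftInvertible ring (1# - y * x) → LeftInvertible ring (1# - x * y)
  leftInvertible-swap x y (u , p) = 1# + x * u * y , (begin
    (1# + x * u * y) * (1# - x * y)                     ≈⟨ distribʳ (1# - x * y) 1# (x * u * y) ⟩
    1# * (1# - x * y) + x * u * y * (1# - x * y)        ≈⟨ +-cong (*-identityˡ _) key ⟩
    (1# - x * y) + x * y                                ≈⟨ x-y+y≈x 1# (x * y) ⟩
    1#                                                  ∎)
    where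
    open Eq
    key : x * u * y * (1# - x * y) ≈ x * y
    key = begin
      x * u * y * (1# - x * y)        ≈⟨ *-assoc (x * u) y (1# - x * y) ⟩
      x * u * (y * (1# - x * y))      ≈⟨ *-congˡ (x[y-z]≈xy-xz y 1# (x * y)) ⟩
      x * u * (y * 1# - y * (x * y))  ≈⟨ *-congˡ (-‿cong₂ (trans (*-identityʳ y) (sym (*-identityˡ y))) (sym (*-assoc y x y))) ⟩
      x * u * (1# * y - y * x * y)    ≈⟨ *-congˡ (sym ([y-z]x≈yx-zx y 1# (y * x))) ⟩
      x * u * ((1# - y * x) * y)      ≈⟨ sym (*-assoc (x * u) (1# - y * x) y) ⟩
      x * u * (1# - y * x) * y        ≈⟨ *-congʳ (*-assoc x u (1# - y * x)) ⟩
      x * (u * (1# - y * x)) * y      ≈⟨ *-congʳ (trans (*-congˡ p) (*-identityʳ x)) ⟩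
      x * y                           ∎

  J-*ʳ : ∀ r {x} → J x → J (x * r)
  J-*ʳ r {x} h = leftInvertible⇒J λ s →
    let u , p = leftInvertible-swap (s * x) r
          (let v , q = J⇒leftInvertible h (r * s)
           in v , trans (*-congˡ (-‿cong₂ refl (sym (*-assoc r s x)))) q)
    in u , trans (*-congˡ (-‿cong₂ refl (sym (*-assoc s x r)))) p

  1∉J : ¬ J 1#
  1∉J h = let u , p = J⇒leftInvertible h 1# in
    1≉0 (trans (sym p) (trans (*-congˡ (trans (-‿cong₂ refl (*-identityˡ 1#)) (-‿inverseʳ 1#))) (zeroʳ u)))

  infix 4 _≈ᴶ_
  _≈ᴶ_ : Carrier → Carrier → Set (a ⊔ ℓ)
  x ≈ᴶ y = J (x - y)

  ≈⇒≈ᴶ : ∀ {x y} → x ≈ y → x ≈ᴶ y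
  ≈⇒≈ᴶ {x} {y} x≈y = J-resp (sym (trans (+-congʳ x≈y) (-‿inverseʳ y))) J-0

  -- R / J, as a setoid quotient.
  quotientRing : Ring a (a ⊔ ℓ)
  quotientRing = record
    { Carrier = Carrier
    ; _≈_ = _≈ᴶ_
    ; _+_ = _+_
    ; _*_ = _*_
    ; -_  = -_
    ; 0#  = 0#
    ; 1#  = 1#
    ; isRing = record
      { +-isAbelianGroup = record
        { isGroup = record
          { isMonoid = record
            { isSemigroup = record
              { isMagma = record
                { isEquivalence = record
                  { refl  = ≈⇒≈ᴶ refl
                  ; sym   = λ {x} {y} h → J-resp (⁻¹-anti-homo‿- x y) (J-neg h)
                  ; trans = λ {x} {y} {z} h k → J-resp (telescope x y z) (J-+ h k)
                  }
                ; ∙-cong = λ {x} {x′} {y} {y′} h k → J-resp (sym (swap x y x′ y′)) (J-+ h k)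
                }
              ; assoc = λ x y z → ≈⇒≈ᴶ (+-assoc x y z)
              }
            ; identity = (λ x → ≈⇒≈ᴶ (+-identityˡ x)) , (λ x → ≈⇒≈ᴶ (+-identityʳ x))
            }
          ; inverse = (λ x → ≈⇒≈ᴶ (-‿inverseˡ x)) , (λ x → ≈⇒≈ᴶ (-‿inverseʳ x))
          ; ⁻¹-cong = λ {x} {y} h → J-resp (sym (-‿+-comm x (- y))) (J-neg h)
          }
        ; comm = λ x y → ≈⇒≈ᴶ (+-comm x y)
        }
      ; *-cong = λ {x} {x′} {y} {y′} h k → J-resp
          (trans (+-cong (x[y-z]≈xy-xz x y y′) ([y-z]x≈yx-zx y′ x x′)) (telescope (x * y) (x * y′) (x′ * y′)))
          (J-+ (J-*ˡ x k) (J-*ʳ y′ h))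
      ; *-assoc = λ x y z → ≈⇒≈ᴶ (*-assoc x y z)
      ; *-identity = (λ x → ≈⇒≈ᴶ (*-identityˡ x)) , (λ x → ≈⇒≈ᴶ (*-identityʳ x))
      ; distrib = (λ x y z → ≈⇒≈ᴶ (distribˡ x y z)) , (λ x y z → ≈⇒≈ᴶ (distribʳ x y z))
      }
    }

  private
    quotientDecSetoid : DecSetoid a (a ⊔ ℓ)
    quotientDecSetoid = record
      { isDecEquivalence = record
        { isEquivalence = Ring.isEquivalence quotientRing
        ; _≟_ = λ x y → J? (x - y)
        }
      }
    module Q = DecSetoid quotientDecSetoid

  representatives : List Carrier
  representatives = deduplicate Q._≟_ elements

  ∈-representatives : ∀ x → Any (x ≈ᴶ_) representatives
  ∈-representatives x = ∈-deduplicate⁺ Q.setoid Q._≟_ (λ p q → Q.trans q (Q.sym p)) (Any.map ≈⇒≈ᴶ (∈-elements x))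

  quotient : FiniteRing a (a ⊔ ℓ)
  quotient = record
    { ring = quotientRing
    ; 1≉0 = λ h → 1∉J (J-resp (x-0≈x 1#) h)
    ; order = length representatives
    ; enumeration = record
      { to = λ x → Any.index (∈-representatives x)
      ; from = List.lookup representatives
      ; to-cong = λ {x} {y} h → injective unique
          (Q.trans (Q.sym (found x)) (Q.trans h (found y)))
      ; from-cong = λ { ≡.refl → Q.refl }
      ; inverse = (λ {i} {y} h → injective unique (Q.trans (Q.sym (found y)) h))
                , (λ { {x} ≡.refl → Q.sym (found x) })
      }
    }
    where
    unique = Unique.deduplicate-! quotientDecSetoid elements
    found : ∀ x → x ≈ᴶ List.lookup representatives (Any.index (∈-representatives x))
    found x = Any.lookup-index (∈-representatives x)
    injective : ∀ {xs} → AllPairs (λ x y → ¬ x ≈ᴶ y) xs →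
                ∀ {i j} → List.lookup xs i ≈ᴶ List.lookup xs j → i ≡ j
    injective (_  ∷ _) {zero}  {zero}  _ = ≡.refl
    injective (ps ∷ _) {zero}  {suc j} h = contradiction h (All.lookup ps (Membership.∈-lookup j))
    injective (ps ∷ _) {suc i} {zero}  h = contradiction (Q.sym h) (All.lookup ps (Membership.∈-lookup i))
    injective (_ ∷ qs) {suc i} {suc j} h = ≡.cong suc (injective qs h)

  -- Each class of _≈_ is listed once in elements, so this is the cardinality of J.
  ∣J∣ : ℕ
  ∣J∣ = length (filter J? elements)

-- A finite list of terms a · w, with w a word in the variables; the same word
-- may occur in several terms.
Polynomial : ℕ → Set
Polynomial n = List (ℤ × List (Fin n))

constantTerm : ∀ {n} → Polynomial n → ℤ
constantTerm []                = + 0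
constantTerm ((a , [])    ∷ f) = a ℤ.+ constantTerm f
constantTerm ((a , _ ∷ _) ∷ f) = constantTerm f

module _ {a ℓ} (R : FiniteRing a ℓ) where
  open FiniteRing R
  open RawMonoidDefs +-rawMonoid using () renaming (_×_ to _·ℕ_)

  infixr 8 _·_
  _·_ : ℤ → Carrier → Carrier
  (+ n)    · x = n ·ℕ x
  -[1+ n ] · x = - (suc n ·ℕ x)

  evalWord : ∀ {n} → List (Fin n) → Vector Carrier n → Carrier
  evalWord w x = List.foldr _*_ 1# (List.map x w)

  eval : ∀ {n} → Polynomial n → Vector Carrier n → Carrier
  eval f x = List.foldr _+_ 0# (List.map (λ (a , w) → a · evalWord w x) f)

  vectors : ∀ d → List (Vector Carrier d)
  vectors zero    = Vector.[] ∷ []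
  vectors (suc d) = cartesianProductWith Vector._∷_ elements (vectors d)

  -- Homomorphisms from the additive group of R ^ d to the multiplicative monoid
  -- of ℂ; as the group is finite, the values are automatically roots of unity.
  record Character (d : ℕ) : Set (a ⊔ ℓ) where
    field
      ⟦_⟧    : Vector Carrier d → ℂ
      cong   : ∀ {x y} → (∀ i → x i ≈ y i) → ⟦ x ⟧ ≈ℂ ⟦ y ⟧
      0-homo : ⟦ (λ _ → 0#) ⟧ ≈ℂ 1ℂ
      +-homo : ∀ x y → ⟦ (λ i → x i + y i) ⟧ ≈ℂ ⟦ x ⟧ *ℂ ⟦ y ⟧

  open Character public using (⟦_⟧)

  Trivial : ∀ {d} → Character d → Set a
  Trivial ψ = ∀ x → ⟦ ψ ⟧ x ≈ℂ 1ℂ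

  order^-_ : ℕ → ℝ
  order^- d = ℚ⇒ℝ (ℚ._/_ (+ 1) (order ℕ.^ d) {{ℕ.m^n≢0 order d {{order-nonZero}}}})

  module _ {d t} {T : Pred (Vector Carrier d) t} (T? : Decidable T) where

    members : List (Vector Carrier d)
    members = filter T? (vectors d)

    fourier : Character d → ℂ
    fourier ψ = ℝ⇒ℂ (order^- d) *ℂ sumℂ (List.map ⟦ ψ ⟧ members)

    IsSalem : ℝ → Set (a ⊔ ℓ)
    IsSalem C = ∀ (ψ : Character d) → ¬ Trivial ψ →
      ∣ fourier ψ ∣ℂ ≤ℝ C *ℝ order^- d *ℝ √ (ℕ⇒ℝ (length members))

  module _ {n} (f : Polynomial n) (c : ℤ) where

    V : Pred (Vector Carrier (suc n)) ℓ
    V x = Vector.last x ≈ eval f (Vector.init x) + c · 1#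

    V? : Decidable V
    V? x = Vector.last x ≟ eval f (Vector.init x) + c · 1#

    -- C is the smallest real number for which V is C-Salem.
    IsSalemNumber : ℝ → Set (a ⊔ ℓ)
    IsSalemNumber C = IsSalem V? C × (∀ C′ → IsSalem V? C′ → C ≤ℝ C′)

{-# OPTIONS --safe #-}

-- R and S = R/J have the same carrier, so a character ψ of S^d is also a character of R^d.
-- V is the graph of x ↦ f(x) + c over the first n = d - 1 coordinates, and reduction modulo J
-- makes each point of S^n the image of |J|^n points of R^n. Hence both |V| and the sum of ψ
-- over V are |J|^n times larger for R than for S, and the Salem inequality for R with
-- constant C gives the one for S with constant C / √|J|^n; now use that C_S is the least one.

module Submission where

open import Algebra.Bundles using (CommutativeMonoid)
import Algebra.Properties.CommutativeMonoid.Mult as Mult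
import Algebra.Properties.CommutativeSemigroup as CommutativeSemigroupProperties
import Algebra.Properties.Ring as RingProperties
open import Data.Bool.Base using (if_then_else_; true; false)
open import Data.Fin.Base using (zero; suc)
open import Data.Integer using (ℤ; +_; -[1+_])
import Data.Integer.Base as ℤ
import Data.Integer.Properties as ℤ
open import Data.List.Base using (List; []; _∷_; _++_; filter; length; map; foldr; cartesianProductWith)
open import Data.List.Properties using (length-tabulate)
open import Data.List.Relation.Unary.All using (All; []; _∷_)
open import Data.List.Relation.Unary.AllPairs using (_∷_)
open import Data.List.Relation.Unary.Any using (Any; here; there)
open import Data.List.Relation.Unary.Unique.Setoid using (Unique)
import Data.List.Relation.Unary.Unique.Setoid.Properties as Unique
open import Data.Nat using (ℕ; zero; suc; _≤_; _^_)
import Data.Nat.Base as ℕ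
import Data.Nat.Properties as ℕ
open import Data.Product using (_,_; proj₁; proj₂; ∃-syntax)
open import Data.Rational.Base as ℚ using (ℚ; 0ℚ; 1ℚ; ½)
import Data.Rational.Properties as ℚ
open import Data.Rational.Solver using (module +-*-Solver)
import Data.Rational.Unnormalised.Base as ℚᵘ
import Data.Rational.Unnormalised.Properties as ℚᵘ
open import Data.Sum.Base using (inj₁; inj₂)
open import Data.Vec.Functional as Vector using (Vector)
open import Function.Base using (_∘_)
open import Function.Bundles using (Inverse)
open import Level using (Level; 0ℓ)
open import Relation.Binary.Bundles using (Setoid)
import Relation.Binary.Definitions as B
open import Relation.Binary.PropositionalEquality as ≡ using (_≡_)
import Relation.Binary.Reasoning.Setoid as SetoidReasoning
open import Relation.Nullary using (¬_; Dec; yes; no; does; contradiction)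
open import Relation.Unary using (Pred; Decidable)
open import Defs

open +-*-Solver using (solve; _:=_; con) renaming (_:+_ to _⊕_; _:*_ to _⊗_; _:-_ to _⊖_; :-_ to ⊝_)

-- The exponent comes from the normalisation. Since |R|^d = |J|^d |S|^d while the character sum
-- grows only by |J|^(d-1), the Fourier coefficient over S is |J| times the one over R. In the bound
-- for R, |R|^-d contributes |J|^-d and √|V| contributes |J|^((d-1)/2), so the powers of |J| add up
-- to 1 - d + (d-1)/2 = -(d-1)/2. Counting V and summing ψ over V obey the same fibre argument,
-- which is therefore carried out once, for sums in an arbitrary commutative monoid, and then used
-- in ℕ and in ℂ. The elements of R and the representatives of R/J form two different lists, with
-- entries comparable only up to ring equality. Reindexing thus means inserting an indicator sum
-- that equals the summand, exchanging the two sums and collapsing the other one. On the real side √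
-- is only approximated at each index, so facts about √ are obtained by comparing squares of
-- nonnegative reals, and 1/√k is taken as √k/k. The power |J|^((d-1)/2) is the square root of
-- |J|^(d-1).

private
  variable
    b p q : Level
    A B C : Set b
    P : Set p
    Q : Set q

-- The graph of f + c

-- `vectors` builds tuples from the front, whereas `V` constrains the last coordinate; this is the
-- bridge between the two.
snoc : ∀ {n} → Vector A n → A → Vector A (suc n)
snoc {n = zero}  x e = e Vector.∷ Vector.[]
snoc {n = suc n} x e = x zero Vector.∷ snoc (x ∘ suc) e

last-snoc : ∀ {n} (x : Vector A n) e → Vector.last (snoc x e) ≡ e
last-snoc {n = zero}  x e = ≡.refl
last-snoc {n = suc n} x e = last-snoc (x ∘ suc) e

init-snoc : ∀ {n} (x : Vector A n) e i → Vector.init (snoc x e) i ≡ x i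
init-snoc x e zero    = ≡.refl
init-snoc x e (suc i) = init-snoc (x ∘ suc) e i

module _ {a ℓ} (R : FiniteRing a ℓ) where
  private module R = FiniteRing R

  infix 4 _≋_
  _≋_ : ∀ {d} → Vector R.Carrier d → Vector R.Carrier d → Set ℓ
  x ≋ y = ∀ i → x i R.≈ y i

  elements-unique : Unique R.setoid R.elements
  elements-unique = Unique.tabulate⁺ R.setoid λ {i} {j} h → ≡.trans (≡.sym (Inverse.strictlyInverseˡ R.enumeration i))
    (≡.trans (Inverse.to-cong R.enumeration h) (Inverse.strictlyInverseˡ R.enumeration j))

  snoc-cong : ∀ {n} {x y : Vector R.Carrier n} {e e′} → x ≋ y → e R.≈ e′ → snoc x e ≋ snoc y e′
  snoc-cong {zero}  x≋y e≈e′ zero    = e≈e′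
  snoc-cong {suc n} x≋y e≈e′ zero    = x≋y zero
  snoc-cong {suc n} x≋y e≈e′ (suc i) = snoc-cong (x≋y ∘ suc) e≈e′ i

  ∷-congˡ : ∀ {n} e {x y : Vector R.Carrier n} → x ≋ y → (e Vector.∷ x) ≋ (e Vector.∷ y)
  ∷-congˡ e x≋y zero    = R.refl
  ∷-congˡ e x≋y (suc i) = x≋y i

  ∷-congʳ : ∀ {n e e′} {x : Vector R.Carrier n} → e R.≈ e′ → (e Vector.∷ x) ≋ (e′ Vector.∷ x)
  ∷-congʳ e≈e′ zero    = e≈e′
  ∷-congʳ e≈e′ (suc i) = R.refl

  evalWord-cong : ∀ {n} w {x y : Vector R.Carrier n} → x ≋ y → evalWord R w x R.≈ evalWord R w y
  evalWord-cong []      x≋y = R.refl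
  evalWord-cong (i ∷ w) x≋y = R.*-cong (x≋y i) (evalWord-cong w x≋y)

  open Mult R.+-commutativeMonoid using () renaming (×-congʳ to ·ℕ-congʳ)

  ·-cong : ∀ k {x y} → x R.≈ y → _·_ R k x R.≈ _·_ R k y
  ·-cong (+ n)    x≈y = ·ℕ-congʳ n x≈y
  ·-cong -[1+ n ] x≈y = R.-‿cong (·ℕ-congʳ (suc n) x≈y)

  eval-cong : ∀ {n} f {x y : Vector R.Carrier n} → x ≋ y → eval R f x R.≈ eval R f y
  eval-cong []            x≋y = R.refl
  eval-cong ((k , w) ∷ f) x≋y = R.+-cong (·-cong k (evalWord-cong w x≋y)) (eval-cong f x≋y)

  module _ {n} (f : Polynomial n) (c : ℤ) where

    lift : Vector R.Carrier n → Vector R.Carrier (suc n)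
    lift x = snoc x (eval R f x R.+ _·_ R c R.1#)

    lift-cong : ∀ {x y} → x ≋ y → lift x ≋ lift y
    lift-cong x≋y = snoc-cong x≋y (R.+-congʳ (eval-cong f x≋y))

    V-resp : ∀ {x y} → x ≋ y → V R f c x → V R f c y
    V-resp x≋y v = R.trans (R.sym (x≋y _)) (R.trans v (R.+-congʳ (eval-cong f (λ i → x≋y _))))

    -- `Vector.init (snoc x e)` agrees with `x` only coordinate by coordinate, so the equality
    -- passes through `eval-cong` and lives in the ring.
    graph-snoc : ∀ x e → eval R f (Vector.init (snoc x e)) R.+ _·_ R c R.1# R.≈ eval R f x R.+ _·_ R c R.1#
    graph-snoc x e = R.+-congʳ (eval-cong f (λ i → R.reflexive (init-snoc x e i)))

-- Evaluation of polynomials in R and in R / J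

module _ {a ℓ} (R : FiniteRing a ℓ) where
  private module R = FiniteRing R

  -- `quotient R` keeps the operations of R and changes only the equality, so this and the
  -- evaluations below agree as elements of the carrier, not merely modulo J.
  ·-quotient-pos : ∀ n x → _·_ R (+ n) x ≡ _·_ (quotient R) (+ n) x
  ·-quotient-pos zero    x = ≡.refl
  ·-quotient-pos (suc n) x = ≡.cong (x R.+_) (·-quotient-pos n x)

  ·-quotient : ∀ k x → _·_ R k x ≡ _·_ (quotient R) k x
  ·-quotient (+ n)    x = ·-quotient-pos n x
  ·-quotient -[1+ n ] x = ≡.cong R.-_ (·-quotient-pos (suc n) x)

  evalWord-quotient : ∀ {n} w (x : Vector R.Carrier n) → evalWord R w x ≡ evalWord (quotient R) w x
  evalWord-quotient []      x = ≡.refl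
  evalWord-quotient (i ∷ w) x = ≡.cong (x i R.*_) (evalWord-quotient w x)

  eval-quotient : ∀ {n} f (x : Vector R.Carrier n) → eval R f x ≡ eval (quotient R) f x
  eval-quotient []            x = ≡.refl
  eval-quotient ((k , w) ∷ f) x = ≡.cong₂ R._+_
    (≡.trans (·-quotient k (evalWord R w x)) (≡.cong (_·_ (quotient R) k) (evalWord-quotient w x)))
    (eval-quotient f x)

  lift-quotient : ∀ {n} (f : Polynomial n) c x → lift R f c x ≡ lift (quotient R) f c x
  lift-quotient f c x = ≡.cong (snoc x) (≡.cong₂ R._+_ (eval-quotient f x) (·-quotient c R.1#))

-- Sums over lists in a commutative monoid

module ListSum {c ℓ} (M : CommutativeMonoid c ℓ) where
  open CommutativeMonoid M
  open CommutativeSemigroupProperties commutativeSemigroup using (interchange)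
  open Mult M using (_×_; ×-congʳ; ×-congˡ; ×-distrib-+; ×-assocˡ)
  open SetoidReasoning setoid

  Σ : List A → (A → Carrier) → Carrier
  Σ xs g = foldr _∙_ ε (map g xs)

  Σ-cong : ∀ (xs : List A) {g h} → (∀ x → g x ≈ h x) → Σ xs g ≈ Σ xs h
  Σ-cong []       g≈h = refl
  Σ-cong (x ∷ xs) g≈h = ∙-cong (g≈h x) (Σ-cong xs g≈h)

  Σ-ε : ∀ (xs : List A) → Σ xs (λ _ → ε) ≈ ε
  Σ-ε []       = refl
  Σ-ε (x ∷ xs) = trans (identityˡ _) (Σ-ε xs)

  Σ-∙ : ∀ (xs : List A) g h → Σ xs (λ x → g x ∙ h x) ≈ Σ xs g ∙ Σ xs h
  Σ-∙ []       g h = sym (identityˡ ε)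
  Σ-∙ (x ∷ xs) g h = trans (∙-congˡ (Σ-∙ xs g h)) (interchange _ _ _ _)

  Σ-swap : ∀ (xs : List A) (ys : List B) (g : A → B → Carrier) → Σ xs (λ x → Σ ys (g x)) ≈ Σ ys (λ y → Σ xs (λ x → g x y))
  Σ-swap []       ys g = sym (Σ-ε ys)
  Σ-swap (x ∷ xs) ys g = trans (∙-congˡ (Σ-swap xs ys g)) (sym (Σ-∙ ys (g x) _))

  Σ-++ : ∀ (xs ys : List A) g → Σ (xs ++ ys) g ≈ Σ xs g ∙ Σ ys g
  Σ-++ []       ys g = sym (identityˡ _)
  Σ-++ (x ∷ xs) ys g = trans (∙-congˡ (Σ-++ xs ys g)) (sym (assoc _ _ _))

  Σ-map : ∀ (f : A → B) xs g → Σ (map f xs) g ≈ Σ xs (g ∘ f)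
  Σ-map f []       g = refl
  Σ-map f (x ∷ xs) g = ∙-congˡ (Σ-map f xs g)

  Σ-cartesianProductWith : ∀ (f : A → B → C) xs ys g →
    Σ (cartesianProductWith f xs ys) g ≈ Σ xs (λ x → Σ ys (λ y → g (f x y)))
  Σ-cartesianProductWith f []       ys g = refl
  Σ-cartesianProductWith f (x ∷ xs) ys g = trans (Σ-++ (map (f x) ys) _ g)
    (∙-cong (Σ-map (f x) ys g) (Σ-cartesianProductWith f xs ys g))

  Σ-const : ∀ (xs : List A) m → Σ xs (λ _ → m) ≈ length xs × m
  Σ-const []       m = refl
  Σ-const (x ∷ xs) m = ∙-congˡ (Σ-const xs m)

  Σ-× : ∀ k (xs : List A) g → Σ xs (λ x → k × g x) ≈ k × Σ xs g
  Σ-× k []       g = sym (×-ε k)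
    where
    ×-ε : ∀ k → k × ε ≈ ε
    ×-ε zero    = refl
    ×-ε (suc k) = trans (identityˡ _) (×-ε k)
  Σ-× k (x ∷ xs) g = trans (∙-congˡ (Σ-× k xs g)) (sym (×-distrib-+ _ _ k))

  -- An indicator inside the summand, in place of a filtered list, makes a double sum over a
  -- relation symmetric in its two lists, so that `Σ-swap` applies.
  when : Dec P → Carrier → Carrier
  when P? m = if does P? then m else ε

  when-cong : ∀ (P? : Dec P) (Q? : Dec Q) {m n} → (P → Q) → (Q → P) → (P → m ≈ n) → when P? m ≈ when Q? n
  when-cong (yes p) (yes q) to from m≈n = m≈n p
  when-cong (yes p) (no ¬q) to from m≈n = contradiction (to p) ¬q
  when-cong (no ¬p) (yes q) to from m≈n = contradiction (from q) ¬p
  when-cong (no ¬p) (no ¬q) to from m≈n = refl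

  Σ-filter : ∀ {P : Pred A p} (P? : Decidable P) xs g → Σ (filter P? xs) g ≈ Σ xs (λ x → when (P? x) (g x))
  Σ-filter P? []       g = refl
  Σ-filter P? (x ∷ xs) g with does (P? x)
  ... | true  = ∙-congˡ (Σ-filter P? xs g)
  ... | false = trans (Σ-filter P? xs g) (sym (identityˡ _))

  Σ-when-const : ∀ {P : Pred A p} (P? : Decidable P) xs m →
    Σ xs (λ x → when (P? x) m) ≈ length (filter P? xs) × m
  Σ-when-const P? xs m = trans (sym (Σ-filter P? xs (λ _ → m))) (Σ-const (filter P? xs) m)

  module _ {s ℓ₂} (S : Setoid s ℓ₂) where
    private module S = Setoid S

    -- Exactly one entry is equivalent to `y`: one exists by membership, and a second would
    -- contradict uniqueness. That entry need not be `y` itself, hence the condition that `g`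
    -- respects the equivalence.
    Σ-indicator : ∀ (_≟_ : B.Decidable S._≈_) {xs} → Unique S xs → ∀ {y} → Any (y S.≈_) xs →
      ∀ (g : S.Carrier → Carrier) → (∀ {x} → x S.≈ y → g x ≈ g y) → Σ xs (λ x → when (x ≟ y) (g x)) ≈ g y
    Σ-indicator _≟_ {x ∷ xs} (x≉ ∷ _) {y} (here y≈x) g g-resp with x ≟ y
    ... | no  x≉y = contradiction (S.sym y≈x) x≉y
    ... | yes x≈y = trans (∙-cong (g-resp x≈y) (rest x≉)) (identityʳ _)
      where
      rest : ∀ {xs} → All (λ z → ¬ x S.≈ z) xs → Σ xs (λ x → when (x ≟ y) (g x)) ≈ ε
      rest []         = refl
      rest {z ∷ _} (x≉z ∷ ps) with z ≟ y
      ... | yes z≈y = contradiction (S.trans (S.sym y≈x) (S.sym z≈y)) x≉z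
      ... | no  _   = trans (identityˡ _) (rest ps)
    Σ-indicator _≟_ {x ∷ xs} (x≉ ∷ unique) {y} (there y∈xs) g g-resp with x ≟ y
    ... | yes x≈y = contradiction x≈y (lookup x≉ y∈xs)
      where
      lookup : ∀ {xs} → All (λ z → ¬ x S.≈ z) xs → Any (y S.≈_) xs → ¬ x S.≈ y
      lookup (x≉z ∷ _) (here y≈z)   x≈y = x≉z (S.trans x≈y y≈z)
      lookup (_ ∷ ps)  (there y∈xs) x≈y = lookup ps y∈xs x≈y
    ... | no  _   = trans (identityˡ _) (Σ-indicator _≟_ unique y∈xs g g-resp)

  -- Sums over R, over its powers and over the graph

  module _ {a ℓ₂} (R : FiniteRing a ℓ₂) where
    private module R = FiniteRing R
    open RingProperties R.ring using (//-rightDividesˡ; //-rightDividesʳ)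

    Σ-elements-indicator : ∀ y (g : R.Carrier → Carrier) → (∀ {x} → x R.≈ y → g x ≈ g y) →
      Σ R.elements (λ x → when (x R.≟ y) (g x)) ≈ g y
    Σ-elements-indicator y = Σ-indicator R.setoid R._≟_ (elements-unique R) (R.∈-elements y)

    -- Translation permutes the classes of R but not literally the list of elements. The permutation
    -- is replaced by the relation y = x - s, equivalent to x = y + s, whose indicator can be summed
    -- out on either side.
    Σ-translate : ∀ s (g : R.Carrier → Carrier) → (∀ {x y} → x R.≈ y → g x ≈ g y) →
      Σ R.elements (λ x → g (x R.- s)) ≈ Σ R.elements g
    Σ-translate s g g-resp = begin
      Σ R.elements (λ x → g (x R.- s))
        ≈⟨ Σ-cong R.elements (λ x → Σ-elements-indicator (x R.- s) g g-resp) ⟨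
      Σ R.elements (λ x → Σ R.elements (λ y → when (y R.≟ x R.- s) (g y)))
        ≈⟨ Σ-swap R.elements R.elements _ ⟩
      Σ R.elements (λ y → Σ R.elements (λ x → when (y R.≟ x R.- s) (g y)))
        ≈⟨ Σ-cong R.elements (λ y → Σ-cong R.elements λ x → when-cong (y R.≟ x R.- s) (x R.≟ y R.+ s)
             (λ h → R.trans (R.sym (//-rightDividesˡ s x)) (R.+-congʳ (R.sym h)))
             (λ h → R.trans (R.sym (//-rightDividesʳ s y)) (R.+-congʳ (R.sym h)))
             (λ _ → refl)) ⟩
      Σ R.elements (λ y → Σ R.elements (λ x → when (x R.≟ y R.+ s) (g y)))
        ≈⟨ Σ-cong R.elements (λ y → Σ-elements-indicator (y R.+ s) (λ _ → g y) (λ _ → refl)) ⟩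
      Σ R.elements g ∎

    -- The last coordinate varies fastest in `vectors`, so both sides run through the tuples in the
    -- same order and no exchange of sums is needed.
    Σ-vectors-snoc : ∀ n (G : Vector R.Carrier (suc n) → Carrier) → (∀ {x y} → _≋_ R x y → G x ≈ G y) →
      Σ (vectors R (suc n)) G ≈ Σ (vectors R n) (λ x → Σ R.elements (λ e → G (snoc x e)))
    Σ-vectors-snoc zero G G-resp = begin
      Σ (vectors R 1) G                                    ≈⟨ Σ-cartesianProductWith Vector._∷_ R.elements _ G ⟩
      Σ R.elements (λ e → G (e Vector.∷ Vector.[]) ∙ ε)    ≈⟨ Σ-cong R.elements (λ e → identityʳ _) ⟩
      Σ R.elements (λ e → G (e Vector.∷ Vector.[]))        ≈⟨ identityʳ _ ⟨
      Σ R.elements (λ e → G (e Vector.∷ Vector.[])) ∙ ε    ∎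
    Σ-vectors-snoc (suc n) G G-resp = begin
      Σ (vectors R (suc (suc n))) G
        ≈⟨ Σ-cartesianProductWith Vector._∷_ R.elements _ G ⟩
      Σ R.elements (λ a → Σ (vectors R (suc n)) (λ v → G (a Vector.∷ v)))
        ≈⟨ Σ-cong R.elements (λ a → Σ-vectors-snoc n (λ v → G (a Vector.∷ v)) (G-resp ∘ ∷-congˡ R a)) ⟩
      Σ R.elements (λ a → Σ (vectors R n) (λ x → Σ R.elements (λ e → G (a Vector.∷ snoc x e))))
        ≈⟨ Σ-cartesianProductWith Vector._∷_ R.elements _ _ ⟨
      Σ (vectors R (suc n)) (λ x → Σ R.elements (λ e → G (snoc x e))) ∎

    module _ {n} (f : Polynomial n) (c : ℤ) where

      -- With the last coordinate `e` split off, membership in `V` becomes the condition e = f(x) +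
      -- c, which a single `e` satisfies; the inner sum collapses to the value at `lift R f c x`.
      Σ-V : ∀ (G : Vector R.Carrier (suc n) → Carrier) → (∀ {x y} → _≋_ R x y → G x ≈ G y) →
        Σ (members R (V? R f c)) G ≈ Σ (vectors R n) (G ∘ lift R f c)
      Σ-V G G-resp = begin
        Σ (members R (V? R f c)) G
          ≈⟨ Σ-filter (V? R f c) (vectors R (suc n)) G ⟩
        Σ (vectors R (suc n)) (λ x → when (V? R f c x) (G x))
          ≈⟨ Σ-vectors-snoc n _ (λ {x} {y} x≋y → when-cong (V? R f c x) (V? R f c y)
               (V-resp R f c x≋y) (V-resp R f c (R.sym ∘ x≋y)) (λ _ → G-resp x≋y)) ⟩
        Σ (vectors R n) (λ x → Σ R.elements (λ e → when (V? R f c (snoc x e)) (G (snoc x e))))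
          ≈⟨ Σ-cong (vectors R n) (λ x → Σ-cong R.elements λ e →
               when-cong (V? R f c (snoc x e)) (e R.≟ eval R f x R.+ _·_ R c R.1#)
                 (λ v → R.trans (R.reflexive (≡.sym (last-snoc x e))) (R.trans v (graph-snoc R f c x e)))
                 (λ h → R.trans (R.reflexive (last-snoc x e)) (R.trans h (R.sym (graph-snoc R f c x e))))
                 (λ _ → refl)) ⟩
        Σ (vectors R n) (λ x → Σ R.elements (λ e → when (e R.≟ eval R f x R.+ _·_ R c R.1#) (G (snoc x e))))
          ≈⟨ Σ-cong (vectors R n) (λ x → Σ-elements-indicator _ (G ∘ snoc x) (G-resp ∘ snoc-cong R (λ _ → R.refl))) ⟩
        Σ (vectors R n) (G ∘ lift R f c) ∎

  -- Reduction of sums modulo J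

  module _ {a ℓ₂} (R : FiniteRing a ℓ₂) where
    private
      module R = FiniteRing R
      module S = FiniteRing (quotient R)

    -- Group the elements of R by their representative s: the fibre over s is the translate J + s.
    Σ-elements-quotient : ∀ (g : R.Carrier → Carrier) → (∀ {x y} → x S.≈ y → g x ≈ g y) →
      Σ R.elements g ≈ ∣J∣ R × Σ S.elements g
    Σ-elements-quotient g g-resp = begin
      Σ R.elements g
        ≈⟨ Σ-cong R.elements (λ x → Σ-elements-indicator (quotient R) x g g-resp) ⟨
      Σ R.elements (λ x → Σ S.elements (λ s → when (s S.≟ x) (g s)))
        ≈⟨ Σ-swap R.elements S.elements _ ⟩
      Σ S.elements (λ s → Σ R.elements (λ x → when (s S.≟ x) (g s)))
        ≈⟨ Σ-cong S.elements (λ s → Σ-cong R.elements λ x → when-cong (s S.≟ x) (J? R (x R.- s))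
             (S.sym {s} {x}) (S.sym {x} {s}) (λ _ → refl)) ⟩
      Σ S.elements (λ s → Σ R.elements (λ x → when (J? R (x R.- s)) (g s)))
        ≈⟨ Σ-cong S.elements (λ s → Σ-translate R s _ λ {x} {y} x≈y → when-cong (J? R x) (J? R y)
             (J-resp R x≈y) (J-resp R (R.sym x≈y)) (λ _ → refl)) ⟩
      Σ S.elements (λ s → Σ R.elements (λ x → when (J? R x) (g s)))
        ≈⟨ Σ-cong S.elements (λ s → Σ-when-const (J? R) R.elements (g s)) ⟩
      Σ S.elements (λ s → ∣J∣ R × g s)
        ≈⟨ Σ-× (∣J∣ R) S.elements g ⟩
      ∣J∣ R × Σ S.elements g ∎

    -- Each coordinate contributes one factor |J|, by induction on the number of coordinates.
    Σ-vectors-quotient : ∀ n (G : Vector R.Carrier n → Carrier) → (∀ {x y} → _≋_ (quotient R) x y → G x ≈ G y) →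
      Σ (vectors R n) G ≈ (∣J∣ R ℕ.^ n) × Σ (vectors (quotient R) n) G
    Σ-vectors-quotient zero    G G-resp = sym (identityʳ _)
    Σ-vectors-quotient (suc n) G G-resp = begin
      Σ (vectors R (suc n)) G
        ≈⟨ Σ-cartesianProductWith Vector._∷_ R.elements _ G ⟩
      Σ R.elements (λ a → Σ (vectors R n) (λ v → G (a Vector.∷ v)))
        ≈⟨ Σ-cong R.elements (λ a → Σ-vectors-quotient n _ (G-resp ∘ ∷-congˡ (quotient R) a)) ⟩
      Σ R.elements (λ a → (∣J∣ R ℕ.^ n) × Σ (vectors (quotient R) n) (λ v → G (a Vector.∷ v)))
        ≈⟨ Σ-× (∣J∣ R ℕ.^ n) R.elements _ ⟩
      (∣J∣ R ℕ.^ n) × Σ R.elements (λ a → Σ (vectors (quotient R) n) (λ v → G (a Vector.∷ v)))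
        -- As `G` respects congruence modulo J, the inner sum depends on `a` only modulo J.
        ≈⟨ ×-congʳ (∣J∣ R ℕ.^ n) (Σ-elements-quotient _ λ a≈b → Σ-cong (vectors (quotient R) n) λ v → G-resp (∷-congʳ (quotient R) a≈b)) ⟩
      (∣J∣ R ℕ.^ n) × ∣J∣ R × Σ S.elements (λ a → Σ (vectors (quotient R) n) (λ v → G (a Vector.∷ v)))
        ≈⟨ ×-congʳ (∣J∣ R ℕ.^ n) (×-congʳ (∣J∣ R) (Σ-cartesianProductWith Vector._∷_ S.elements _ G)) ⟨
      (∣J∣ R ℕ.^ n) × ∣J∣ R × Σ (vectors (quotient R) (suc n)) G
        ≈⟨ ×-assocˡ _ (∣J∣ R ℕ.^ n) (∣J∣ R) ⟩
      (∣J∣ R ℕ.^ n ℕ.* ∣J∣ R) × Σ (vectors (quotient R) (suc n)) G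
        ≈⟨ ×-congˡ {Σ (vectors (quotient R) (suc n)) G} (ℕ.*-comm (∣J∣ R ℕ.^ n) (∣J∣ R)) ⟩
      (∣J∣ R ℕ.^ suc n) × Σ (vectors (quotient R) (suc n)) G ∎

    -- Both graphs are parametrised by their first n coordinates, through the same function `lift`.
    -- Only these n coordinates are free, so the factor is |J|^n and not |J|^(n+1).
    Σ-V-quotient : ∀ {n} (f : Polynomial n) c (G : Vector R.Carrier (suc n) → Carrier) → (∀ {x y} → _≋_ (quotient R) x y → G x ≈ G y) →
      Σ (members R (V? R f c)) G ≈ (∣J∣ R ℕ.^ n) × Σ (members (quotient R) (V? (quotient R) f c)) G
    Σ-V-quotient {n} f c G G-resp = begin
      Σ (members R (V? R f c)) G
        ≈⟨ Σ-V R f c G (λ x≋y → G-resp (≈⇒≈ᴶ R ∘ x≋y)) ⟩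
      Σ (vectors R n) (G ∘ lift R f c)
        ≈⟨ Σ-cong (vectors R n) (λ x → reflexive (≡.cong G (lift-quotient R f c x))) ⟩
      Σ (vectors R n) (G ∘ lift (quotient R) f c)
        ≈⟨ Σ-vectors-quotient n (G ∘ lift (quotient R) f c) (G-resp ∘ lift-cong (quotient R) f c) ⟩
      (∣J∣ R ℕ.^ n) × Σ (vectors (quotient R) n) (G ∘ lift (quotient R) f c)
        ≈⟨ ×-congʳ (∣J∣ R ℕ.^ n) (Σ-V (quotient R) f c G G-resp) ⟨
      (∣J∣ R ℕ.^ n) × Σ (members (quotient R) (V? (quotient R) f c)) G ∎

-- Cardinalities of R, of R / J and of the graphs

module _ where
  open ListSum ℕ.+-0-commutativeMonoid
  open Mult ℕ.+-0-commutativeMonoid using (_×_)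

  ×≡* : ∀ k m → k × m ≡ k ℕ.* m
  ×≡* zero    m = ≡.refl
  ×≡* (suc k) m = ≡.cong (m ℕ.+_) (×≡* k m)

  Σ-1 : ∀ (xs : List A) → Σ xs (λ _ → 1) ≡ length xs
  Σ-1 xs = ≡.trans (Σ-const xs 1) (≡.trans (×≡* (length xs) 1) (ℕ.*-identityʳ _))

  module _ {a ℓ} (R : FiniteRing a ℓ) where
    private
      module R = FiniteRing R
      module S = FiniteRing (quotient R)

    -- Lagrange's theorem for J, as the case of the constant summand 1 in ℕ.
    order-quotient : R.order ≡ ∣J∣ R ℕ.* S.order
    order-quotient = begin
      R.order                              ≡⟨ length-tabulate R.element ⟨
      length R.elements                    ≡⟨ Σ-1 R.elements ⟨
      Σ R.elements (λ _ → 1)               ≡⟨ Σ-elements-quotient R (λ _ → 1) (λ _ → ≡.refl) ⟩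
      ∣J∣ R × Σ S.elements (λ _ → 1)       ≡⟨ ≡.cong (∣J∣ R ×_) (Σ-1 S.elements) ⟩
      ∣J∣ R × length S.elements            ≡⟨ ×≡* (∣J∣ R) _ ⟩
      ∣J∣ R ℕ.* length S.elements          ≡⟨ ≡.cong (∣J∣ R ℕ.*_) (length-tabulate S.element) ⟩
      ∣J∣ R ℕ.* S.order                    ∎
      where open ≡.≡-Reasoning

    ∣V∣-quotient : ∀ {n} (f : Polynomial n) c →
      length (members R (V? R f c)) ≡ ∣J∣ R ℕ.^ n ℕ.* length (members (quotient R) (V? (quotient R) f c))
    ∣V∣-quotient {n} f c = begin
      length (members R (V? R f c))                     ≡⟨ Σ-1 (members R (V? R f c)) ⟨
      Σ (members R (V? R f c)) (λ _ → 1)                ≡⟨ Σ-V-quotient R f c (λ _ → 1) (λ _ → ≡.refl) ⟩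
      (∣J∣ R ℕ.^ n) × Σ (members (quotient R) (V? (quotient R) f c)) (λ _ → 1)  ≡⟨ ≡.cong ((∣J∣ R ℕ.^ n) ×_) (Σ-1 (members (quotient R) (V? (quotient R) f c))) ⟩
      (∣J∣ R ℕ.^ n) × length (members (quotient R) (V? (quotient R) f c))     ≡⟨ ×≡* (∣J∣ R ℕ.^ n) _ ⟩
      ∣J∣ R ℕ.^ n ℕ.* length (members (quotient R) (V? (quotient R) f c))     ∎
      where open ≡.≡-Reasoning

-- Square roots of Cauchy reals

p≤p+ε : ∀ p {ε} → 0ℚ ℚ.< ε → p ℚ.≤ p ℚ.+ ε
p≤p+ε p {ε} 0<ε = ≡.subst (ℚ._≤ p ℚ.+ ε) (ℚ.+-identityʳ p) (ℚ.+-monoʳ-≤ p (ℚ.<⇒≤ 0<ε))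

½ε≤ε : ∀ {ε} → 0ℚ ℚ.< ε → ½ ℚ.* ε ℚ.≤ ε
½ε≤ε {ε} 0<ε = ≡.subst (½ ℚ.* ε ℚ.≤_) (½+½ ε) (p≤p+ε (½ ℚ.* ε) (½-pos 0<ε))

*-nonNeg : ∀ {p q} → 0ℚ ℚ.≤ p → 0ℚ ℚ.≤ q → 0ℚ ℚ.≤ p ℚ.* q
*-nonNeg {p} {q} 0≤p 0≤q = ≡.subst (ℚ._≤ p ℚ.* q) (ℚ.*-zeroˡ 0ℚ) (*-mono-≤-nonNeg 0≤p ℚ.≤-refl 0≤p 0≤q)

square-nonNeg : ∀ p → 0ℚ ℚ.≤ p ℚ.* p
square-nonNeg p = ≡.subst (0ℚ ℚ.≤_) (∣p∣²≡p² p) (*-nonNeg (ℚ.0≤∣p∣ p) (ℚ.0≤∣p∣ p))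
  where
  ∣p∣²≡p² : ∀ p → ℚ.∣ p ∣ ℚ.* ℚ.∣ p ∣ ≡ p ℚ.* p
  ∣p∣²≡p² p with ℚ.∣p∣≡p∨∣p∣≡-p p
  ... | inj₁ e = ≡.cong₂ ℚ._*_ e e
  ... | inj₂ e = ≡.trans (≡.cong₂ ℚ._*_ e e) (solve 1 (λ p → (⊝ p) ⊗ (⊝ p) := p ⊗ p) ≡.refl p)

≤ℝ-reflexive-pointwise : ∀ {x y} → (∀ n → seq x n ≡ seq y n) → x ≤ℝ y
≤ℝ-reflexive-pointwise {x} h ε 0<ε = 0 , λ n _ → ≡.subst (λ z → seq x n ℚ.≤ z ℚ.+ ε) (h n) (p≤p+ε (seq x n) 0<ε)

≤ℝ-trans : ∀ {x y z} → x ≤ℝ y → y ≤ℝ z → x ≤ℝ z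
≤ℝ-trans {x} {y} {z} x≤y y≤z ε 0<ε =
  let M , h = x≤y (½ ℚ.* ε) (½-pos 0<ε)
      N , k = y≤z (½ ℚ.* ε) (½-pos 0<ε)
  in M ℕ.⊔ N , λ n n≥ → ≡.subst (seq x n ℚ.≤_)
       (≡.trans (ℚ.+-assoc (seq z n) (½ ℚ.* ε) (½ ℚ.* ε)) (≡.cong (seq z n ℚ.+_) (½+½ ε)))
       (ℚ.≤-trans (h n (ℕ.m⊔n≤o⇒m≤o M N n≥)) (ℚ.+-monoˡ-≤ (½ ℚ.* ε) (k n (ℕ.m⊔n≤o⇒n≤o M N n≥))))

≤ℝ-antisym : ∀ {x y} → x ≤ℝ y → y ≤ℝ x → x ≈ℝ y
≤ℝ-antisym {x} {y} x≤y y≤x ε 0<ε =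
  let M , h = x≤y ε 0<ε
      N , k = y≤x ε 0<ε
  in M ℕ.⊔ N , λ n n≥ → ≤+⇒∣-∣≤ (seq x n) (seq y n) (h n (ℕ.m⊔n≤o⇒m≤o M N n≥)) (k n (ℕ.m⊔n≤o⇒n≤o M N n≥))

∣-∣-sym : ∀ p q → ℚ.∣ p ℚ.- q ∣ ≡ ℚ.∣ q ℚ.- p ∣
∣-∣-sym p q = ≡.trans (≡.sym (ℚ.∣-p∣≡∣p∣ (p ℚ.- q))) (≡.cong ℚ.∣_∣ (solve 2 (λ p q → ⊝ (p ⊖ q) := q ⊖ p) ≡.refl p q))

≈ℝ-sym : ∀ {x y} → x ≈ℝ y → y ≈ℝ x
≈ℝ-sym {x} {y} h ε 0<ε = let N , k = h ε 0<ε in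
  N , λ n n≥ → ≡.subst (ℚ._≤ ε) (∣-∣-sym (seq x n) (seq y n)) (k n n≥)

≈ℝ⇒≤ℝ : ∀ {x y} → x ≈ℝ y → x ≤ℝ y
≈ℝ⇒≤ℝ {x} {y} h ε 0<ε = let N , k = h ε 0<ε in N , λ n n≥ → ∣-∣≤⇒≤+ (seq x n) (seq y n) (k n n≥)

≈ℝ-trans : ∀ {x y z} → x ≈ℝ y → y ≈ℝ z → x ≈ℝ z
≈ℝ-trans {x} {y} {z} h k = ≤ℝ-antisym {x} {z}
  (≤ℝ-trans {x} {y} {z} (≈ℝ⇒≤ℝ {x} {y} h) (≈ℝ⇒≤ℝ {y} {z} k))
  (≤ℝ-trans {z} {y} {x} (≈ℝ⇒≤ℝ {z} {y} (≈ℝ-sym {y} {z} k)) (≈ℝ⇒≤ℝ {y} {x} (≈ℝ-sym {x} {y} h)))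

-- Sums, products and negatives of reals are formed term by term, so every ring identity over ℚ
-- transfers to ℝ through this lemma.
pointwise : ∀ {x y} → (∀ n → seq x n ≡ seq y n) → x ≈ℝ y
pointwise {x} {y} h = ≤ℝ-antisym {x} {y} (≤ℝ-reflexive-pointwise {x} {y} h) (≤ℝ-reflexive-pointwise {y} {x} (≡.sym ∘ h))

≈ℝ-refl : ∀ {x} → x ≈ℝ x
≈ℝ-refl {x} = pointwise {x} {x} (λ _ → ≡.refl)

ℝ-setoid : Setoid 0ℓ 0ℓ
ℝ-setoid = record
  { Carrier = ℝ ; _≈_ = _≈ℝ_
  ; isEquivalence = record
    { refl = λ {x} → ≈ℝ-refl {x} ; sym = λ {x} {y} → ≈ℝ-sym {x} {y} ; trans = λ {x} {y} {z} → ≈ℝ-trans {x} {y} {z} }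
  }

+ℝ-mono-≤ : ∀ {x x′ y y′} → x ≤ℝ x′ → y ≤ℝ y′ → x +ℝ y ≤ℝ x′ +ℝ y′
+ℝ-mono-≤ {x} {x′} {y} {y′} h k ε 0<ε =
  let M , p = h (½ ℚ.* ε) (½-pos 0<ε)
      N , q = k (½ ℚ.* ε) (½-pos 0<ε)
  in M ℕ.⊔ N , λ n n≥ → ≡.subst (seq x n ℚ.+ seq y n ℚ.≤_)
       (≡.trans (solve 3 (λ a b e → (a ⊕ e) ⊕ (b ⊕ e) := (a ⊕ b) ⊕ (e ⊕ e)) ≡.refl (seq x′ n) (seq y′ n) (½ ℚ.* ε))
         (≡.cong (seq x′ n ℚ.+ seq y′ n ℚ.+_) (½+½ ε)))
       (ℚ.+-mono-≤ (p n (ℕ.m⊔n≤o⇒m≤o M N n≥)) (q n (ℕ.m⊔n≤o⇒n≤o M N n≥)))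

+ℝ-cong : ∀ {x x′ y y′} → x ≈ℝ x′ → y ≈ℝ y′ → x +ℝ y ≈ℝ x′ +ℝ y′
+ℝ-cong {x} {x′} {y} {y′} h k = ≤ℝ-antisym {x +ℝ y} {x′ +ℝ y′}
  (+ℝ-mono-≤ {x} {x′} {y} {y′} (≈ℝ⇒≤ℝ {x} {x′} h) (≈ℝ⇒≤ℝ {y} {y′} k))
  (+ℝ-mono-≤ {x′} {x} {y′} {y} (≈ℝ⇒≤ℝ {x′} {x} (≈ℝ-sym {x} {x′} h)) (≈ℝ⇒≤ℝ {y′} {y} (≈ℝ-sym {y} {y′} k)))

*ℝ-comm : ∀ x y → x *ℝ y ≈ℝ y *ℝ x
*ℝ-comm x y = pointwise {x *ℝ y} {y *ℝ x} λ n → ℚ.*-comm (seq x n) (seq y n)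

-- From some index on, the terms of `z` are bounded by B; closeness of `x` and `y` within η, where B
-- η = ½ ε, is then enough.
*ℝ-congʳ : ∀ z {x y} → x ≈ℝ y → x *ℝ z ≈ℝ y *ℝ z
*ℝ-congʳ z {x} {y} x≈y ε 0<ε =
  let B , 1≤B , K , bounded = eventually-bounded z
      η , 0<η , Bη = scale B 1≤B ε 0<ε
      N , close = x≈y η 0<η
      0≤B = ℚ.≤-trans (ℚ.nonNegative⁻¹ 1ℚ) 1≤B
  in K ℕ.⊔ N , λ n n≥ →
       let a = seq x n ; b = seq y n ; c = seq z n in
       ℚ.≤-trans (≡.subst₂ ℚ._≤_
         (≡.trans (≡.sym (ℚ.∣p*q∣≡∣p∣*∣q∣ c (a ℚ.- b)))
           (≡.cong ℚ.∣_∣ (solve 3 (λ a b c → c ⊗ (a ⊖ b) := (a ⊗ c) ⊖ (b ⊗ c)) ≡.refl a b c)))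
         Bη
         (*-mono-≤-nonNeg 0≤B (ℚ.0≤∣p∣ (a ℚ.- b)) (bounded n (ℕ.m⊔n≤o⇒m≤o K N n≥)) (close n (ℕ.m⊔n≤o⇒n≤o K N n≥))))
         (½ε≤ε 0<ε)

*ℝ-congˡ : ∀ z {x y} → x ≈ℝ y → z *ℝ x ≈ℝ z *ℝ y
*ℝ-congˡ z {x} {y} x≈y = begin
  z *ℝ x  ≈⟨ *ℝ-comm z x ⟩
  x *ℝ z  ≈⟨ *ℝ-congʳ z {x} {y} x≈y ⟩
  y *ℝ z  ≈⟨ *ℝ-comm y z ⟩
  z *ℝ y  ∎
  where open SetoidReasoning ℝ-setoid

*ℝ-cong : ∀ {x x′ y y′} → x ≈ℝ x′ → y ≈ℝ y′ → x *ℝ y ≈ℝ x′ *ℝ y′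
*ℝ-cong {x} {x′} {y} {y′} h k = ≈ℝ-trans {x *ℝ y} {x′ *ℝ y} {x′ *ℝ y′} (*ℝ-congʳ y {x} {x′} h) (*ℝ-congˡ x′ {y} {y′} k)

-- Stronger than 0 ≤ x, which only bounds the terms below by an arbitrarily small negative number.
NonNegative : ℝ → Set
NonNegative x = ∀ n → 0ℚ ℚ.≤ seq x n

√-nonNeg : ∀ x → NonNegative (√ x)
√-nonNeg x n = √ℚ-nonNeg (seq x n) n

*ℝ-nonNeg : ∀ {x y} → NonNegative x → NonNegative y → NonNegative (x *ℝ y)
*ℝ-nonNeg 0≤x 0≤y n = *-nonNeg (0≤x n) (0≤y n)

ℕ⇒ℝ-nonNeg : ∀ k → NonNegative (ℕ⇒ℝ k)
ℕ⇒ℝ-nonNeg k n = /-nonNeg k 0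

-- A term c ≥ 0 turns a ≤ b + η into a c ≤ b c + c η, and the slack c η is at most B η = ½ ε once c
-- ≤ B.
*ℝ-monoʳ-≤ : ∀ z {x y} → NonNegative z → x ≤ℝ y → x *ℝ z ≤ℝ y *ℝ z
*ℝ-monoʳ-≤ z {x} {y} 0≤z x≤y ε 0<ε =
  let B , 1≤B , K , bounded = eventually-bounded z
      η , 0<η , Bη = scale B 1≤B ε 0<ε
      N , close = x≤y η 0<η
  in K ℕ.⊔ N , λ n n≥ →
       let a = seq x n ; b = seq y n ; c = seq z n
           c≤B = ℚ.≤-trans (p≤∣p∣ c) (bounded n (ℕ.m⊔n≤o⇒m≤o K N n≥))
       in ℚ.≤-trans
            (ℚ.*-monoʳ-≤-nonNeg c {{ℚ.nonNegative (0≤z n)}} (close n (ℕ.m⊔n≤o⇒n≤o K N n≥)))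
            (≡.subst (ℚ._≤ b ℚ.* c ℚ.+ ε) (solve 3 (λ b c e → (b ⊗ c) ⊕ (c ⊗ e) := (b ⊕ e) ⊗ c) ≡.refl b c η)
              (ℚ.+-monoʳ-≤ (b ℚ.* c) (ℚ.≤-trans
                (ℚ.*-monoʳ-≤-nonNeg η {{ℚ.nonNegative (ℚ.<⇒≤ 0<η)}} c≤B)
                (≡.subst (ℚ._≤ ε) (≡.sym Bη) (½ε≤ε 0<ε)))))

-- At index n the approximate root s satisfies s² ≤ x < (s + 1/(n+1))², with x for the n-th term;
-- nonnegativity of the terms removes the truncation `0ℚ ⊔_` hidden in `√ℚ`.
√-* : ∀ x → NonNegative x → √ x *ℝ √ x ≈ℝ x
√-* x 0≤x = ≤ℝ-antisym {√ x *ℝ √ x} {x} below above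
  where
  0⊔ : ∀ n → 0ℚ ℚ.⊔ seq x n ≡ seq x n
  0⊔ n = ℚ.p≤q⇒p⊔q≡q (0≤x n)
  below : √ x *ℝ √ x ≤ℝ x
  below ε 0<ε = 0 , λ n _ → ℚ.≤-trans
    (≡.subst (√ℚ (seq x n) n ℚ.* √ℚ (seq x n) n ℚ.≤_) (0⊔ n) (proj₁ (√ℚ-spec (seq x n) n)))
    (p≤p+ε (seq x n) 0<ε)
  shifted : ∀ {δ} → 0ℚ ℚ.< δ → ∃[ N ] ∀ n → N ℕ.≤ n → seq x n ℚ.≤ (seq (√ x) n ℚ.+ δ) ℚ.* (seq (√ x) n ℚ.+ δ)
  shifted {δ} 0<δ =
    let N , tiny = archimedean δ 0<δ in
    N , λ n n≥ →
      let s = √ℚ (seq x n) n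
          s+≤ = ℚ.+-monoʳ-≤ s (tiny n n≥)
          0≤s+ = ℚ.+-mono-≤ (√ℚ-nonNeg (seq x n) n) (/-nonNeg 1 n)
      in ℚ.≤-trans (≡.subst (ℚ._≤ (s ℚ.+ (+ 1 ℚ./ suc n)) ℚ.* (s ℚ.+ (+ 1 ℚ./ suc n))) (0⊔ n) (ℚ.<⇒≤ (proj₂ (√ℚ-spec (seq x n) n))))
           (*-mono-≤-nonNeg (ℚ.≤-trans 0≤s+ s+≤) 0≤s+ s+≤ s+≤)
  above : x ≤ℝ √ x *ℝ √ x
  above ε 0<ε =
    let B , 1≤B , K , bounded = eventually-bounded (√ x)
        0≤B = ℚ.≤-trans (ℚ.nonNegative⁻¹ 1ℚ) 1≤B
        -- (s + δ)² exceeds s² by (2s + δ) δ. For s ≤ B and δ ≤ 1 the first factor is at most 2B +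
        -- 1; capping δ at 1 below secures the second condition.
        B′ = B ℚ.+ B ℚ.+ 1ℚ
        1≤B′ = ≡.subst (ℚ._≤ B′) (ℚ.+-identityˡ 1ℚ) (ℚ.+-monoˡ-≤ 1ℚ (ℚ.+-mono-≤ 0≤B 0≤B))
        η , 0<η , B′η = scale B′ 1≤B′ ε 0<ε
        δ = η ℚ.⊓ 1ℚ
        0<δ = ⊓-pos 0<η
        0≤δ = ℚ.<⇒≤ 0<δ
        N , close = shifted 0<δ
    in K ℕ.⊔ N , λ n n≥ →
         let s = seq (√ x) n
             s≤B = ℚ.≤-trans (p≤∣p∣ s) (bounded n (ℕ.m⊔n≤o⇒m≤o K N n≥))
             factor≤ : s ℚ.+ s ℚ.+ δ ℚ.≤ B′
             factor≤ = ℚ.+-mono-≤ (ℚ.+-mono-≤ s≤B s≤B) (ℚ.p⊓q≤q η 1ℚ)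
         in ℚ.≤-trans (close n (ℕ.m⊔n≤o⇒n≤o K N n≥))
              (≡.subst (ℚ._≤ s ℚ.* s ℚ.+ ε)
                (solve 2 (λ s d → (s ⊗ s) ⊕ ((s ⊕ s ⊕ d) ⊗ d) := (s ⊕ d) ⊗ (s ⊕ d)) ≡.refl s δ)
                (ℚ.+-monoʳ-≤ (s ℚ.* s) (ℚ.≤-trans
                  (*-mono-≤-nonNeg (ℚ.≤-trans (ℚ.nonNegative⁻¹ 1ℚ) 1≤B′) 0≤δ factor≤ (ℚ.p⊓q≤p η 1ℚ))
                  (≡.subst (ℚ._≤ ε) (≡.sym B′η) (½ε≤ε 0<ε)))))
    where
    ⊓-pos : ∀ {η} → 0ℚ ℚ.< η → 0ℚ ℚ.< η ℚ.⊓ 1ℚ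
    ⊓-pos {η} 0<η with ℚ.⊓-sel η 1ℚ
    ... | inj₁ e = ≡.subst (0ℚ ℚ.<_) (≡.sym e) 0<η
    ... | inj₂ e = ≡.subst (0ℚ ℚ.<_) (≡.sym e) (ℚ.positive⁻¹ 1ℚ)

-- A tolerance ε² between the squares gives ε between the terms: if a > b + ε with b ≥ 0, then a² >
-- (b + ε)² ≥ b² + ε².
square-cancel-≤ : ∀ {x y} → NonNegative y → x *ℝ x ≤ℝ y *ℝ y → x ≤ℝ y
square-cancel-≤ {x} {y} 0≤y x²≤y² ε 0<ε =
  let 0<ε² = ≡.subst (ℚ._< ε ℚ.* ε) (ℚ.*-zeroʳ ε) (ℚ.*-monoʳ-<-pos ε {{ℚ.positive 0<ε}} 0<ε)
      0≤ε = ℚ.<⇒≤ 0<ε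
      N , h = x²≤y² (ε ℚ.* ε) 0<ε²
  in N , λ n n≥ → ℚ.≮⇒≥ λ y+ε<x →
       let a = seq x n ; b = seq y n
           0≤b+ε = ℚ.+-mono-≤ (0≤y n) 0≤ε
           strict : (b ℚ.+ ε) ℚ.* (b ℚ.+ ε) ℚ.< a ℚ.* a
           strict = ℚ.≤-<-trans
             (ℚ.*-monoˡ-≤-nonNeg (b ℚ.+ ε) {{ℚ.nonNegative 0≤b+ε}} (ℚ.<⇒≤ y+ε<x))
             (ℚ.*-monoˡ-<-pos a {{ℚ.positive (ℚ.≤-<-trans 0≤b+ε y+ε<x)}} y+ε<x)
           expand : b ℚ.* b ℚ.+ ε ℚ.* ε ℚ.≤ (b ℚ.+ ε) ℚ.* (b ℚ.+ ε)
           expand = ≡.subst₂ ℚ._≤_ (ℚ.+-identityʳ _)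
             (solve 2 (λ b e → (b ⊗ b) ⊕ (e ⊗ e) ⊕ ((b ⊗ e) ⊕ (b ⊗ e)) := (b ⊕ e) ⊗ (b ⊕ e)) ≡.refl b ε)
             (ℚ.+-monoʳ-≤ (b ℚ.* b ℚ.+ ε ℚ.* ε) (ℚ.+-mono-≤ (*-nonNeg (0≤y n) 0≤ε) (*-nonNeg (0≤y n) 0≤ε)))
       in ℚ.<-irrefl ≡.refl (ℚ.<-≤-trans strict (ℚ.≤-trans (h n n≥) expand))

square-cancel : ∀ {x y} → NonNegative x → NonNegative y → x *ℝ x ≈ℝ y *ℝ y → x ≈ℝ y
square-cancel {x} {y} 0≤x 0≤y h = ≤ℝ-antisym {x} {y}
  (square-cancel-≤ {x} {y} 0≤y (≈ℝ⇒≤ℝ {x *ℝ x} {y *ℝ y} h))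
  (square-cancel-≤ {y} {x} 0≤x (≈ℝ⇒≤ℝ {y *ℝ y} {x *ℝ x} (≈ℝ-sym {x *ℝ x} {y *ℝ y} h)))

-- The rational approximations are not multiplicative, but both sides are nonnegative with the same
-- square.
√-homo-* : ∀ x y → NonNegative x → NonNegative y → √ (x *ℝ y) ≈ℝ √ x *ℝ √ y
√-homo-* x y 0≤x 0≤y = square-cancel {√ (x *ℝ y)} {√ x *ℝ √ y} (√-nonNeg (x *ℝ y))
  (*ℝ-nonNeg {√ x} {√ y} (√-nonNeg x) (√-nonNeg y)) (begin
    √ (x *ℝ y) *ℝ √ (x *ℝ y)           ≈⟨ √-* (x *ℝ y) (*ℝ-nonNeg {x} {y} 0≤x 0≤y) ⟩
    x *ℝ y                             ≈⟨ *ℝ-cong {√ x *ℝ √ x} {x} {√ y *ℝ √ y} {y} (√-* x 0≤x) (√-* y 0≤y) ⟨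
    (√ x *ℝ √ x) *ℝ (√ y *ℝ √ y)       ≈⟨ pointwise {(√ x *ℝ √ x) *ℝ (√ y *ℝ √ y)} {(√ x *ℝ √ y) *ℝ (√ x *ℝ √ y)} (λ n →
                                            solve 2 (λ a b → (a ⊗ a) ⊗ (b ⊗ b) := (a ⊗ b) ⊗ (a ⊗ b)) ≡.refl (seq (√ x) n) (seq (√ y) n)) ⟩
    (√ x *ℝ √ y) *ℝ (√ x *ℝ √ y)       ∎)
  where open SetoidReasoning ℝ-setoid

∣z∣²-nonNeg : ∀ z → NonNegative (re z *ℝ re z +ℝ im z *ℝ im z)
∣z∣²-nonNeg z n = ℚ.+-mono-≤ (square-nonNeg (seq (re z) n)) (square-nonNeg (seq (im z) n))

-- Both sides are nonnegative, and both have the square k² (re w² + im w²).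
∣∣ℂ-scale : ∀ k z w → NonNegative k → re z ≈ℝ k *ℝ re w → im z ≈ℝ k *ℝ im w → ∣ z ∣ℂ ≈ℝ k *ℝ ∣ w ∣ℂ
∣∣ℂ-scale k z w 0≤k h h′ = square-cancel {∣ z ∣ℂ} {k *ℝ ∣ w ∣ℂ} (√-nonNeg (norm z))
  (*ℝ-nonNeg {k} {∣ w ∣ℂ} 0≤k (√-nonNeg (norm w))) (begin
    ∣ z ∣ℂ *ℝ ∣ z ∣ℂ                                             ≈⟨ √-* (norm z) (∣z∣²-nonNeg z) ⟩
    re z *ℝ re z +ℝ im z *ℝ im z                                 ≈⟨ +ℝ-cong {re z *ℝ re z} {kr *ℝ kr} {im z *ℝ im z} {ki *ℝ ki}
                                                                      (*ℝ-cong {re z} {kr} {re z} {kr} h h)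
                                                                      (*ℝ-cong {im z} {ki} {im z} {ki} h′ h′) ⟩
    kr *ℝ kr +ℝ ki *ℝ ki                                         ≈⟨ pointwise {kr *ℝ kr +ℝ ki *ℝ ki} {(k *ℝ k) *ℝ norm w} (λ n →
                                                                      solve 3 (λ k a b → ((k ⊗ a) ⊗ (k ⊗ a)) ⊕ ((k ⊗ b) ⊗ (k ⊗ b))
                                                                                        := (k ⊗ k) ⊗ ((a ⊗ a) ⊕ (b ⊗ b))) ≡.refl
                                                                        (seq k n) (seq (re w) n) (seq (im w) n)) ⟩
    (k *ℝ k) *ℝ norm w                                           ≈⟨ *ℝ-congˡ (k *ℝ k) {∣ w ∣ℂ *ℝ ∣ w ∣ℂ} {norm w} (√-* (norm w) (∣z∣²-nonNeg w)) ⟨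
    (k *ℝ k) *ℝ (∣ w ∣ℂ *ℝ ∣ w ∣ℂ)                               ≈⟨ pointwise {(k *ℝ k) *ℝ (∣ w ∣ℂ *ℝ ∣ w ∣ℂ)} {(k *ℝ ∣ w ∣ℂ) *ℝ (k *ℝ ∣ w ∣ℂ)} (λ n →
                                                                      solve 2 (λ a b → (a ⊗ a) ⊗ (b ⊗ b) := (a ⊗ b) ⊗ (a ⊗ b)) ≡.refl
                                                                        (seq k n) (seq ∣ w ∣ℂ n)) ⟩
    (k *ℝ ∣ w ∣ℂ) *ℝ (k *ℝ ∣ w ∣ℂ)                               ∎)
  where
  open SetoidReasoning ℝ-setoid
  norm : ℂ → ℝ
  norm z = re z *ℝ re z +ℝ im z *ℝ im z
  kr = k *ℝ re w
  ki = k *ℝ im w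

-- The additive monoid of complex numbers

+ℂ-commutativeMonoid : CommutativeMonoid 0ℓ 0ℓ
+ℂ-commutativeMonoid = record
  { Carrier = ℂ ; _≈_ = _≈ℂ_ ; _∙_ = _+ℂ_ ; ε = 0ℂ
  ; isCommutativeMonoid = record
    { isMonoid = record
      { isSemigroup = record
        { isMagma = record
          { isEquivalence = record
            { refl  = λ {z} → ≈ℝ-refl {re z} , ≈ℝ-refl {im z}
            ; sym   = λ {z} {w} (h , k) → ≈ℝ-sym {re z} {re w} h , ≈ℝ-sym {im z} {im w} k
            ; trans = λ {z} {w} {v} (h , k) (h′ , k′) →
                ≈ℝ-trans {re z} {re w} {re v} h h′ , ≈ℝ-trans {im z} {im w} {im v} k k′
            }
          ; ∙-cong = λ {z} {z′} {w} {w′} (h , k) (h′ , k′) →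
              +ℝ-cong {re z} {re z′} {re w} {re w′} h h′ , +ℝ-cong {im z} {im z′} {im w} {im w′} k k′
          }
        ; assoc = λ z w v → assoc (re z) (re w) (re v) , assoc (im z) (im w) (im v)
        }
      ; identity = (λ z → identityˡ (re z) , identityˡ (im z)) , (λ z → identityʳ (re z) , identityʳ (im z))
      }
    ; comm = λ z w → comm (re z) (re w) , comm (im z) (im w)
    }
  }
  where
  assoc : ∀ x y z → (x +ℝ y) +ℝ z ≈ℝ x +ℝ (y +ℝ z)
  assoc x y z = pointwise {(x +ℝ y) +ℝ z} {x +ℝ (y +ℝ z)} λ n → ℚ.+-assoc (seq x n) (seq y n) (seq z n)
  comm : ∀ x y → x +ℝ y ≈ℝ y +ℝ x
  comm x y = pointwise {x +ℝ y} {y +ℝ x} λ n → ℚ.+-comm (seq x n) (seq y n)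
  identityˡ : ∀ x → ℕ⇒ℝ 0 +ℝ x ≈ℝ x
  identityˡ x = pointwise {ℕ⇒ℝ 0 +ℝ x} {x} λ n → ℚ.+-identityˡ (seq x n)
  identityʳ : ∀ x → x +ℝ ℕ⇒ℝ 0 ≈ℝ x
  identityʳ x = pointwise {x +ℝ ℕ⇒ℝ 0} {x} λ n → ℚ.+-identityʳ (seq x n)

-- Natural numbers and their reciprocals in ℚ

fromℕ : ℕ → ℚ
fromℕ k = + k ℚ./ 1

fromℕ-suc : ∀ k → fromℕ (suc k) ≡ 1ℚ ℚ.+ fromℕ k
fromℕ-suc k = ℚ.toℚᵘ-injective (ℚᵘ.≃-trans (toℚᵘ-/ (suc k) 0) (ℚᵘ.≃-sym
  (ℚᵘ.≃-trans (ℚ.toℚᵘ-homo-+ 1ℚ (fromℕ k)) (ℚᵘ.≃-trans (ℚᵘ.+-congʳ ℚᵘ.1ℚᵘ (toℚᵘ-/ k 0))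
    (ℚᵘ.*≡* (≡.cong (λ m → (+ 1 ℤ.+ m) ℤ.* + 1) (ℤ.*-identityʳ (+ k))))))))

fromℕ-* : ∀ m n → fromℕ (m ℕ.* n) ≡ fromℕ m ℚ.* fromℕ n
fromℕ-* m n = ℚ.toℚᵘ-injective (ℚᵘ.≃-trans (toℚᵘ-/ (m ℕ.* n) 0) (ℚᵘ.≃-sym
  (ℚᵘ.≃-trans (ℚ.toℚᵘ-homo-* (fromℕ m) (fromℕ n)) (ℚᵘ.≃-trans (ℚᵘ.*-cong (toℚᵘ-/ m 0) (toℚᵘ-/ n 0))
    (ℚᵘ.*≡* (≡.cong (ℤ._* + 1) (≡.sym (ℤ.pos-* m n))))))))

1/n*n≡1 : ∀ n .{{_ : ℕ.NonZero n}} → (+ 1 ℚ./ n) ℚ.* fromℕ n ≡ 1ℚ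
1/n*n≡1 n@(suc e) = ℚ.toℚᵘ-injective (ℚᵘ.≃-trans (ℚ.toℚᵘ-homo-* (+ 1 ℚ./ n) (fromℕ n))
  (ℚᵘ.≃-trans (ℚᵘ.*-cong (toℚᵘ-/ 1 e) (toℚᵘ-/ n 0))
    (ℚᵘ.*≡* (≡.trans (ℤ.*-identityʳ (+ 1 ℤ.* + n)) (≡.cong (λ k → + 1 ℤ.* (+ k)) (≡.sym (ℕ.*-identityʳ n)))))))

-- Meant for r = |R|^d, s = |S|^d, j = |J| and k = |J|^(d-1): the factor k is absorbed by the
-- character sum, and j remains as the ratio of the Fourier coefficients.
reciprocal : ∀ j k r s .{{_ : ℕ.NonZero r}} .{{_ : ℕ.NonZero s}} → r ≡ j ℕ.* k ℕ.* s →
  + 1 ℚ./ s ≡ fromℕ j ℚ.* (+ 1 ℚ./ r) ℚ.* fromℕ k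
reciprocal j k r s r≡jks = begin
  1/s                                                        ≡⟨ ℚ.*-identityʳ 1/s ⟨
  1/s ℚ.* 1ℚ                                                 ≡⟨ ≡.cong (1/s ℚ.*_) (1/n*n≡1 r) ⟨
  1/s ℚ.* (1/r ℚ.* fromℕ r)                                  ≡⟨ ≡.cong (λ m → 1/s ℚ.* (1/r ℚ.* m)) expand ⟩
  1/s ℚ.* (1/r ℚ.* (fromℕ j ℚ.* fromℕ k ℚ.* fromℕ s))
    ≡⟨ solve 5 (λ s r j k o → s ⊗ (r ⊗ (j ⊗ k ⊗ o)) := (s ⊗ o) ⊗ (j ⊗ r ⊗ k)) ≡.refl 1/s 1/r (fromℕ j) (fromℕ k) (fromℕ s) ⟩
  (1/s ℚ.* fromℕ s) ℚ.* (fromℕ j ℚ.* 1/r ℚ.* fromℕ k)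
    ≡⟨ ≡.cong (ℚ._* (fromℕ j ℚ.* 1/r ℚ.* fromℕ k)) (1/n*n≡1 s) ⟩
  1ℚ ℚ.* (fromℕ j ℚ.* 1/r ℚ.* fromℕ k)                       ≡⟨ ℚ.*-identityˡ _ ⟩
  fromℕ j ℚ.* 1/r ℚ.* fromℕ k                                ∎
  where
  open ≡.≡-Reasoning
  1/s = + 1 ℚ./ s
  1/r = + 1 ℚ./ r
  expand : fromℕ r ≡ fromℕ j ℚ.* fromℕ k ℚ.* fromℕ s
  expand = ≡.trans (≡.cong fromℕ r≡jks)
    (≡.trans (fromℕ-* (j ℕ.* k) s) (≡.cong (ℚ._* fromℕ s) (fromℕ-* j k)))

-- Salem constants of R and of R / J

module _ where
  open Mult +ℂ-commutativeMonoid using (_×_)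

  seq-re-× : ∀ k z n → seq (re (k × z)) n ≡ fromℕ k ℚ.* seq (re z) n
  seq-re-× zero    z n = ≡.sym (ℚ.*-zeroˡ (seq (re z) n))
  seq-re-× (suc k) z n = ≡.trans (≡.cong (seq (re z) n ℚ.+_) (seq-re-× k z n))
    (≡.trans (solve 2 (λ a k → a ⊕ (k ⊗ a) := (con 1ℚ ⊕ k) ⊗ a) ≡.refl (seq (re z) n) (fromℕ k))
      (≡.cong (ℚ._* seq (re z) n) (≡.sym (fromℕ-suc k))))

  seq-im-× : ∀ k z n → seq (im (k × z)) n ≡ fromℕ k ℚ.* seq (im z) n
  seq-im-× zero    z n = ≡.sym (ℚ.*-zeroˡ (seq (im z) n))
  seq-im-× (suc k) z n = ≡.trans (≡.cong (seq (im z) n ℚ.+_) (seq-im-× k z n))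
    (≡.trans (solve 2 (λ a k → a ⊕ (k ⊗ a) := (con 1ℚ ⊕ k) ⊗ a) ≡.refl (seq (im z) n) (fromℕ k))
      (≡.cong (ℚ._* seq (im z) n) (≡.sym (fromℕ-suc k))))

  -- p z = r q k z = r (q w). With `z` and `w` the character sums over S and R, p = |S|^-d, q =
  -- |R|^-d and r = |J|, this compares the two Fourier coefficients.
  ∣∣ℂ-rescale : ∀ p q r k z w → 0ℚ ℚ.≤ r → w ≈ℂ k × z → p ≡ r ℚ.* q ℚ.* fromℕ k →
    ∣ ℝ⇒ℂ (ℚ⇒ℝ p) *ℂ z ∣ℂ ≈ℝ ℚ⇒ℝ r *ℝ ∣ ℝ⇒ℂ (ℚ⇒ℝ q) *ℂ w ∣ℂ
  ∣∣ℂ-rescale p q r k z w 0≤r (w≈re , w≈im) p≡ =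
    ∣∣ℂ-scale (ℚ⇒ℝ r) z′ w′ (λ _ → 0≤r)
      (begin
        re z′                                  ≈⟨ pointwise {re z′} {ℚ⇒ℝ (r ℚ.* q) *ℝ re (k × z)} (λ n → ≡.trans
                                                    -- `con 0ℚ` is the imaginary part of the real
                                                    -- number p embedded in ℂ.
                                                    (solve 3 (λ p a b → (p ⊗ a) ⊕ (⊝ (con 0ℚ ⊗ b)) := p ⊗ a) ≡.refl p (seq (re z) n) (seq (im z) n))
                                                    (coefficient (seq (re z) n) (seq-re-× k z n))) ⟩
        ℚ⇒ℝ (r ℚ.* q) *ℝ re (k × z)            ≈⟨ *ℝ-congˡ (ℚ⇒ℝ (r ℚ.* q)) {re w} {re (k × z)} w≈re ⟨
        ℚ⇒ℝ (r ℚ.* q) *ℝ re w                  ≈⟨ pointwise {ℚ⇒ℝ (r ℚ.* q) *ℝ re w} {ℚ⇒ℝ r *ℝ re w′} (λ n →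
                                                    solve 4 (λ r q a b → (r ⊗ q) ⊗ a := r ⊗ ((q ⊗ a) ⊕ (⊝ (con 0ℚ ⊗ b)))) ≡.refl
                                                      r q (seq (re w) n) (seq (im w) n)) ⟩
        ℚ⇒ℝ r *ℝ re w′                         ∎)
      (begin
        im z′                                  ≈⟨ pointwise {im z′} {ℚ⇒ℝ (r ℚ.* q) *ℝ im (k × z)} (λ n → ≡.trans
                                                    (solve 3 (λ p a b → (p ⊗ b) ⊕ (con 0ℚ ⊗ a) := p ⊗ b) ≡.refl p (seq (re z) n) (seq (im z) n))
                                                    (coefficient (seq (im z) n) (seq-im-× k z n))) ⟩
        ℚ⇒ℝ (r ℚ.* q) *ℝ im (k × z)            ≈⟨ *ℝ-congˡ (ℚ⇒ℝ (r ℚ.* q)) {im w} {im (k × z)} w≈im ⟨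
        ℚ⇒ℝ (r ℚ.* q) *ℝ im w                  ≈⟨ pointwise {ℚ⇒ℝ (r ℚ.* q) *ℝ im w} {ℚ⇒ℝ r *ℝ im w′} (λ n →
                                                    solve 4 (λ r q a b → (r ⊗ q) ⊗ b := r ⊗ ((q ⊗ b) ⊕ (con 0ℚ ⊗ a))) ≡.refl
                                                      r q (seq (re w) n) (seq (im w) n)) ⟩
        ℚ⇒ℝ r *ℝ im w′                         ∎)
    where
    open SetoidReasoning ℝ-setoid
    z′ = ℝ⇒ℂ (ℚ⇒ℝ p) *ℂ z
    w′ = ℝ⇒ℂ (ℚ⇒ℝ q) *ℂ w
    coefficient : ∀ a {b} → b ≡ fromℕ k ℚ.* a → p ℚ.* a ≡ r ℚ.* q ℚ.* b
    coefficient a b≡ = ≡.trans (≡.cong (ℚ._* a) p≡)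
      (≡.trans (ℚ.*-assoc (r ℚ.* q) (fromℕ k) a) (≡.cong (r ℚ.* q ℚ.*_) (≡.sym b≡)))

^-distribʳ-* : ∀ o m n → (m ℕ.* n) ^ o ≡ m ^ o ℕ.* n ^ o
^-distribʳ-* zero    m n = ≡.refl
^-distribʳ-* (suc o) m n = ≡.trans (≡.cong (m ℕ.* n ℕ.*_) (^-distribʳ-* o m n)) (ℕ.[m*n]*[o*p]≡[m*o]*[n*p] m n (m ^ o) (n ^ o))

√-ℕ-* : ∀ m n → √ (ℕ⇒ℝ (m ℕ.* n)) ≈ℝ √ (ℕ⇒ℝ m) *ℝ √ (ℕ⇒ℝ n)
√-ℕ-* m n = ≈ℝ-trans {√ (ℕ⇒ℝ (m ℕ.* n))} {√ (ℕ⇒ℝ m *ℝ ℕ⇒ℝ n)} {√ (ℕ⇒ℝ m) *ℝ √ (ℕ⇒ℝ n)}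
  (pointwise {√ (ℕ⇒ℝ (m ℕ.* n))} {√ (ℕ⇒ℝ m *ℝ ℕ⇒ℝ n)} λ i → ≡.cong (λ q → √ℚ q i) (fromℕ-* m n))
  (√-homo-* (ℕ⇒ℝ m) (ℕ⇒ℝ n) (ℕ⇒ℝ-nonNeg m) (ℕ⇒ℝ-nonNeg n))

-- Serves twice: with k = |J| to carry the Salem bound from R to S, and with k = √(|J|^(d-1)) for
-- the final inequality.
≤ℝ-rescale : ∀ k x y u v → NonNegative k → x ≈ℝ k *ℝ y → y ≤ℝ u → u *ℝ k ≈ℝ v → x ≤ℝ v
≤ℝ-rescale k x y u v 0≤k x≈ky y≤u uk≈v =
  ≤ℝ-trans {x} {k *ℝ y} {v} (≈ℝ⇒≤ℝ {x} {k *ℝ y} x≈ky)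
    (≤ℝ-trans {k *ℝ y} {y *ℝ k} {v} (≈ℝ⇒≤ℝ {k *ℝ y} {y *ℝ k} (*ℝ-comm k y))
      (≤ℝ-trans {y *ℝ k} {u *ℝ k} {v} (*ℝ-monoʳ-≤ k {y} {u} 0≤k y≤u) (≈ℝ⇒≤ℝ {u *ℝ k} {v} uk≈v)))

module _ (k : ℕ) .{{_ : ℕ.NonZero k}} where
  open Mult +ℂ-commutativeMonoid using (_×_)

  -- C / √k, written without dividing by a real number.
  _/√ : ℝ → ℝ
  C /√ = C *ℝ √ (ℕ⇒ℝ k) *ℝ ℚ⇒ℝ (+ 1 ℚ./ k)

  /√-*√ : ∀ C → C /√ *ℝ √ (ℕ⇒ℝ k) ≈ℝ C
  /√-*√ C = begin
    C *ℝ r *ℝ ℚ⇒ℝ i *ℝ r       ≈⟨ pointwise {C *ℝ r *ℝ ℚ⇒ℝ i *ℝ r} {C *ℝ ℚ⇒ℝ i *ℝ (r *ℝ r)} (λ n →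
                                    solve 3 (λ c r i → c ⊗ r ⊗ i ⊗ r := c ⊗ i ⊗ (r ⊗ r)) ≡.refl (seq C n) (seq r n) i) ⟩
    C *ℝ ℚ⇒ℝ i *ℝ (r *ℝ r)     ≈⟨ *ℝ-congˡ (C *ℝ ℚ⇒ℝ i) {r *ℝ r} {ℕ⇒ℝ k} (√-* (ℕ⇒ℝ k) (ℕ⇒ℝ-nonNeg k)) ⟩
    C *ℝ ℚ⇒ℝ i *ℝ ℕ⇒ℝ k        ≈⟨ pointwise {C *ℝ ℚ⇒ℝ i *ℝ ℕ⇒ℝ k} {C} (λ n →
                                    ≡.trans (ℚ.*-assoc (seq C n) i (fromℕ k))
                                      (≡.trans (≡.cong (seq C n ℚ.*_) (1/n*n≡1 k)) (ℚ.*-identityʳ (seq C n)))) ⟩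
    C                          ∎
    where
    open SetoidReasoning ℝ-setoid
    r = √ (ℕ⇒ℝ k)
    i = + 1 ℚ./ k

  module _ (p q j : ℚ) (0≤j : 0ℚ ℚ.≤ j) (p≡jqk : p ≡ j ℚ.* q ℚ.* fromℕ k) where

    -- Since j q = p / k and √(k v) = √k √v, the left side is C (√k / k) p √v, and √k / k is the
    -- factor in `C /√`.
    /√-bound : ∀ C v → C *ℝ ℚ⇒ℝ q *ℝ √ (ℕ⇒ℝ (k ℕ.* v)) *ℝ ℚ⇒ℝ j ≈ℝ C /√ *ℝ ℚ⇒ℝ p *ℝ √ (ℕ⇒ℝ v)
    /√-bound C v = begin
      C *ℝ ℚ⇒ℝ q *ℝ √ (ℕ⇒ℝ (k ℕ.* v)) *ℝ ℚ⇒ℝ j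
        ≈⟨ *ℝ-congʳ (ℚ⇒ℝ j) {C *ℝ ℚ⇒ℝ q *ℝ √ (ℕ⇒ℝ (k ℕ.* v))} {C *ℝ ℚ⇒ℝ q *ℝ (r *ℝ t)}
             (*ℝ-congˡ (C *ℝ ℚ⇒ℝ q) {√ (ℕ⇒ℝ (k ℕ.* v))} {r *ℝ t} (√-ℕ-* k v)) ⟩
      C *ℝ ℚ⇒ℝ q *ℝ (r *ℝ t) *ℝ ℚ⇒ℝ j
        ≈⟨ pointwise {C *ℝ ℚ⇒ℝ q *ℝ (r *ℝ t) *ℝ ℚ⇒ℝ j} {C /√ *ℝ ℚ⇒ℝ p *ℝ t} (λ n → rearrange (seq C n) (seq r n) (seq t n)) ⟩
      C /√ *ℝ ℚ⇒ℝ p *ℝ t ∎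
      where
      open SetoidReasoning ℝ-setoid
      r = √ (ℕ⇒ℝ k)
      t = √ (ℕ⇒ℝ v)
      i = + 1 ℚ./ k
      rearrange : ∀ c r t → c ℚ.* q ℚ.* (r ℚ.* t) ℚ.* j ≡ c ℚ.* r ℚ.* i ℚ.* p ℚ.* t
      rearrange c r t = ≡.sym (≡.trans (≡.cong (λ p → c ℚ.* r ℚ.* i ℚ.* p ℚ.* t) p≡jqk)
        (≡.trans (solve 7 (λ c r t q j k i → c ⊗ r ⊗ i ⊗ (j ⊗ q ⊗ k) ⊗ t := (i ⊗ k) ⊗ (c ⊗ q ⊗ (r ⊗ t) ⊗ j)) ≡.refl
                    c r t q j (fromℕ k) i)
          (≡.trans (≡.cong (ℚ._* (c ℚ.* q ℚ.* (r ℚ.* t) ℚ.* j)) (1/n*n≡1 k)) (ℚ.*-identityˡ _))))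

    /√-≤ : ∀ C z w u v → w ≈ℂ k × z → u ≡ k ℕ.* v →
      ∣ ℝ⇒ℂ (ℚ⇒ℝ q) *ℂ w ∣ℂ ≤ℝ C *ℝ ℚ⇒ℝ q *ℝ √ (ℕ⇒ℝ u) →
      ∣ ℝ⇒ℂ (ℚ⇒ℝ p) *ℂ z ∣ℂ ≤ℝ C /√ *ℝ ℚ⇒ℝ p *ℝ √ (ℕ⇒ℝ v)
    /√-≤ C z w u v w≈kz ≡.refl ∣w∣≤ = ≤ℝ-rescale (ℚ⇒ℝ j)
      ∣ ℝ⇒ℂ (ℚ⇒ℝ p) *ℂ z ∣ℂ
      ∣ ℝ⇒ℂ (ℚ⇒ℝ q) *ℂ w ∣ℂ
      (C *ℝ ℚ⇒ℝ q *ℝ √ (ℕ⇒ℝ (k ℕ.* v)))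
      (C /√ *ℝ ℚ⇒ℝ p *ℝ √ (ℕ⇒ℝ v))
      (λ _ → 0≤j) (∣∣ℂ-rescale p q j k z w 0≤j w≈kz p≡jqk) ∣w∣≤ (/√-bound C v)

module _ {a ℓ} (R : FiniteRing a ℓ) where
  private
    module R = FiniteRing R
    module S = FiniteRing (quotient R)

  pullback : ∀ {d} → Character (quotient R) d → Character R d
  pullback ψ = record
    { ⟦_⟧    = Character.⟦ ψ ⟧
    ; cong   = λ x≈y → Character.cong ψ (λ i → ≈⇒≈ᴶ R (x≈y i))
    ; 0-homo = Character.0-homo ψ
    ; +-homo = Character.+-homo ψ
    }

  ∣J∣-nonZero : ℕ.NonZero (∣J∣ R)
  ∣J∣-nonZero = ℕ.m*n≢0⇒m≢0 (∣J∣ R) {{≡.subst ℕ.NonZero (order-quotient R) R.order-nonZero}}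

  module _ (n : ℕ) where
    instance
      ∣J∣^n-nonZero : ℕ.NonZero (∣J∣ R ^ n)
      ∣J∣^n-nonZero = ℕ.m^n≢0 (∣J∣ R) n {{∣J∣-nonZero}}
    private
      instance
        R-nonZero : ℕ.NonZero (R.order ^ suc n)
        R-nonZero = ℕ.m^n≢0 R.order (suc n) {{R.order-nonZero}}
        S-nonZero : ℕ.NonZero (S.order ^ suc n)
        S-nonZero = ℕ.m^n≢0 S.order (suc n) {{S.order-nonZero}}

    order^-quotient : + 1 ℚ./ (S.order ^ suc n) ≡ fromℕ (∣J∣ R) ℚ.* (+ 1 ℚ./ (R.order ^ suc n)) ℚ.* fromℕ (∣J∣ R ^ n)
    order^-quotient = reciprocal (∣J∣ R) (∣J∣ R ^ n) (R.order ^ suc n) (S.order ^ suc n)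
      -- |J|^(n+1) unfolds to the product of |J| and |J|^n, the two factors that `reciprocal` keeps
      -- apart.
      (≡.trans (≡.cong (_^ suc n) (order-quotient R)) (^-distribʳ-* (suc n) (∣J∣ R) S.order))

    salem-quotient : ∀ (f : Polynomial n) c C →
      IsSalem R (V? R f c) C → IsSalem (quotient R) (V? (quotient R) f c) (_/√ (∣J∣ R ^ n) C)
    salem-quotient f c C salem ψ ψ≠1 = /√-≤ (∣J∣ R ^ n)
      (+ 1 ℚ./ (S.order ^ suc n)) (+ 1 ℚ./ (R.order ^ suc n)) (fromℕ (∣J∣ R)) (/-nonNeg (∣J∣ R) 0) order^-quotient C
      (sumℂ (map Character.⟦ ψ ⟧ (members (quotient R) (V? (quotient R) f c))))
      (sumℂ (map Character.⟦ ψ ⟧ (members R (V? R f c))))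
      (length (members R (V? R f c)))
      (length (members (quotient R) (V? (quotient R) f c)))
      (ListSum.Σ-V-quotient +ℂ-commutativeMonoid R f c Character.⟦ ψ ⟧ (Character.cong ψ))
      (∣V∣-quotient R f c)
      -- Triviality only concerns the values of the character, on the same carrier for R and S, so
      -- `ψ≠1` also says that the pullback is nontrivial.
      (salem (pullback ψ) ψ≠1)

lemma2p26 : ∀ {a ℓ} (d-1 : ℕ) → 2 ≤ suc d-1 →
    (f : Polynomial d-1) → constantTerm f ≡ + 0 → (c : ℤ) →
    (R : FiniteRing a ℓ) (C-R C-S : ℝ) →
    IsSalemNumber R f c C-R → IsSalemNumber (quotient R) f c C-S →
    C-S *ℝ √ (ℕ⇒ℝ (∣J∣ R ^ d-1)) ≤ℝ C-R
lemma2p26 n _ f _ c R C-R C-S (salem , _) (_ , least) =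
  -- The bound of C_S by C_R / √k is multiplied by the nonnegative √k.
  ≤ℝ-rescale (√ (ℕ⇒ℝ k)) (C-S *ℝ √ (ℕ⇒ℝ k)) C-S (_/√ k C-R) C-R (√-nonNeg (ℕ⇒ℝ k)) (*ℝ-comm C-S (√ (ℕ⇒ℝ k)))
    (least (_/√ k C-R) (salem-quotient R n f c C-R salem)) (/√-*√ k C-R)
  where
  k = ∣J∣ R ^ n
  instance
    k-nonZero : ℕ.NonZero k
    k-nonZero = ∣J∣^n-nonZero R n
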